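{- Let $s$ and $d$ be relatively prime positive integers. The number of self-conjugate $(s,s+d,s+2d)$-core partitions is \[ \sum_{i=0}^{\lfloor s/4 \rfloor} \binom{\frac{s+d-1}{2}}{i,\ \frac{d}{2}+i,\ \frac{s-1}{2}-2i}\qquad\text{if $d$ is even,} \] and \[ \sum_{i=0}^{\lfloor s/2\rfloor} \binom{\lfloor \frac{s+d-1}{2}\rfloor}{\lfloor \frac{i}{2} \rfloor,\ \lfloor \frac{d+i}{2}\rfloor,\ \lfloor \frac{s}{2} \rfloor -i}\qquad\text{if $d$ is odd.} \]
   Context: A partition is a finite (possibly empty) non-increasing sequence of positive integers, identified with its Young diagram. The hook length of a box is the number of boxes to its right in the same row plus the number of boxes below it in the same column plus $1$. A partition is an $s$-core if no box has hook length $s$, and an $(s_1,\dots,s_q)$-core if it is an $s_i$-core for every $i$. A partition is self-conjugate if its Young diagram is invariant under reflection in the main diagonal. $\binom{n}{x,y,z}=\frac{n!}{x!\,y!\,z!}$ (with $x+y+z=n$) is the multinomial coefficient. -}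

module Defs where

open import Data.List.Base using (List; []; _∷_; length; filter; drop; map; upTo)
open import Data.List.Membership.Propositional using (_∈_)
open import Data.List.Relation.Unary.All using (All)
open import Data.List.Relation.Unary.Linked using (Linked)
open import Data.List.Relation.Unary.Unique.Propositional using (Unique)
open import Data.Nat.Base using (ℕ; zero; suc; _+_; _*_; _∸_; _<_; _≥_; _!; NonZero)
open import Data.Nat.DivMod using (_/_)
open import Data.Nat.ListAction using (sum)
open import Data.Nat.Properties using (_<?_; _!≢0; m*n≢0)
open import Data.Product.Base using (_×_; ∃-syntax)
open import Function.Bundles using (_⇔_)
open import Relation.Binary.PropositionalEquality using (_≡_; _≢_)

IsPartition : List ℕ → Set
IsPartition p = Linked _≥_ p × All (0 <_) p

-- Rows are numbered from 0; rows past the end of the list are empty.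
row : List ℕ → ℕ → ℕ
row []      _       = 0
row (x ∷ _) zero    = x
row (_ ∷ p) (suc i) = row p i

-- Membership of the box in row i and column j (both numbered from 0) in the
-- Young diagram of p.
Box : List ℕ → ℕ → ℕ → Set
Box p i j = j < row p i

arm : List ℕ → ℕ → ℕ → ℕ
arm p i j = row p i ∸ suc j

-- A row below row i has a box in column j exactly when it is longer than j.
leg : List ℕ → ℕ → ℕ → ℕ
leg p i j = length (filter (j <?_) (drop (suc i) p))

hook : List ℕ → ℕ → ℕ → ℕ
hook p i j = arm p i j + leg p i j + 1

IsCore : ℕ → List ℕ → Set
IsCore s p = ∀ i j → Box p i j → hook p i j ≢ s

IsSimultaneousCore : List ℕ → List ℕ → Set
IsSimultaneousCore ss p = All (λ s → IsCore s p) ss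

IsSelfConjugate : List ℕ → Set
IsSelfConjugate p = ∀ i j → Box p i j ⇔ Box p j i

IsSelfConjugateCorePartition : List ℕ → List ℕ → Set
IsSelfConjugateCorePartition ss p =
  IsPartition p × IsSelfConjugate p × IsSimultaneousCore ss p

-- Exactly n elements satisfy P: they can be listed without repetition in a
-- list of length n.
HasCount : {A : Set} → (A → Set) → ℕ → Set
HasCount {A} P n =
  ∃[ xs ] Unique {A = A} xs × (∀ x → x ∈ xs ⇔ P x) × length xs ≡ n

-- n! / (x! y! z!); the multinomial coefficient when x + y + z = n.
multinomial : ℕ → ℕ → ℕ → ℕ → ℕ
multinomial n x y z = n ! / (x ! * y ! * z !)
  where
  instance
    nonZero : NonZero (x ! * y ! * z !)
    nonZero = m*n≢0 (x ! * y !) (z !)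
                {{m*n≢0 (x !) (y !) {{x !≢0}} {{y !≢0}}}} {{z !≢0}}

sumUpTo : ℕ → (ℕ → ℕ) → ℕ
sumUpTo m f = sum (map f (upTo (suc m)))

syntax sumUpTo m (λ i → e) = ∑[ i ≤ m ] e

-- Send a self-conjugate partition to the set S of the integers row i − i − 1.
-- Exactly one of x and −1 − x lies in S, and the partition is a u-core iff S is
-- closed under x ↦ x − u.  Put t = s + d.  Every integer is r d + n t + c with
-- 0 ≤ r < t for a suitable constant c, and closure under −t makes S the set of
-- points with n < G r for some G : ℕ → ℤ.  Closure under −s and −(s + 2d) says
-- that G changes by at most 1 at each step; moreover G 0 = 0, G t = −d, and the
-- symmetry of S makes the step sequence of G a palindrome.  Hence G is
-- determined by its first ⌊(t − 1)/2⌋ steps, a word over {1, −1, 0} whose sum h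
-- is constrained only by |d + 2h| ≤ 1.  Fixing the numbers of steps of each kind
-- gives the multinomial coefficients.
module Submission where

open import Defs
open import Data.Empty using (⊥-elim)
open import Data.List.Base using (List; []; _∷_; _++_; length; map; filter; drop; upTo; downFrom)
open import Data.List.Membership.Propositional using (_∈_; find; lose)
open import Data.List.Membership.Propositional.Properties using (∈-map⁺; ∈-map⁻; ++-∈⇔; ∈-upTo⁺; ∈-upTo⁻; ∈-filter⁺; ∈-filter⁻; ∈-downFrom⁺)
open import Data.List.Properties using (length-map; length-++; filter-accept; filter-reject)
open import Data.List.Relation.Unary.All as All using (All; []; _∷_)
import Data.List.Relation.Unary.All.Properties as All
open import Data.List.Relation.Unary.AllPairs using ([]; _∷_)
import Data.List.Relation.Unary.AllPairs.Properties as AllPairs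
open import Data.List.Relation.Unary.Any as Any using (Any; here; there)
open import Data.List.Relation.Unary.Linked as Linked using (Linked; []; [-]; _∷_)
open import Data.List.Relation.Unary.Linked.Properties using (AllPairs⇒Linked)
open import Data.List.Relation.Unary.Unique.Propositional using (Unique)
import Data.List.Relation.Unary.Unique.Propositional.Properties as Unique
open import Data.Nat.Base using (ℕ; zero; suc; z≤n; s≤s; s≤s⁻¹; NonZero)
open import Data.Nat.Coprimality using (Coprime; coprime-Bézout; coprime-divisor; coprime-+)
open import Data.Nat.Divisibility using (_∣_; divides; ∣⇒≤; ∣1⇒≡1; ∣m+n∣m⇒∣n)
open import Data.Nat.GCD using (module Bézout)
open import Data.Product.Base using (_×_; _,_; ∃-syntax; proj₁; proj₂)
open import Data.Sum.Base as Sum using (_⊎_; inj₁; inj₂)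
open import Function.Base using (_∘_)
open import Function.Bundles using (_⇔_; mk⇔; Equivalence)
import Function.Properties.Equivalence as ⇔
open import Relation.Binary.Definitions using (tri<; tri≈; tri>)
open import Relation.Binary.PropositionalEquality
open import Relation.Nullary using (¬_; Dec; yes; no)
open Equivalence using (to; from)

-- The coordinates suit the problem because -s = d - t and -(s + 2d) = -d - t: subtracting t, s or s
-- + 2d lowers n by 1 and moves r by 0, 1 or -1. Coprimality of t and d makes every integer a point,
-- unique up to the identification of (r , n) with (r + t , n - d); hence G t = G 0 - d. Reflection
-- exchanges columns r and t - e - r. The constant c is an integer only if e d + t is odd, so e = 0
-- serves odd t, and even t takes e = 1 (d is then odd). In both cases t - e = 2m + 1, and the
-- middle step joins G m to -d - G m, whence the bound on |d + 2h|. For e = 1 one step remains, from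
-- column t - 1 to column t; it joins -d - G 0 to G 0 - d and is flat once G 0 = 0 is known. That
-- equation comes from comparing columns t - e and t. In the other direction a partition must be
-- built from a word. Only the nonnegative elements of S are listed: they are the arm lengths along
-- the main diagonal, so they form a Frobenius symbol, and the symmetry of S accounts for the
-- negative elements.

-- Counting by disjoint unions, finite sums and bijections.

module Counting where

  open import Data.Nat.Base using (_+_; _≤_)
  open import Data.Nat.ListAction using (sum)

  HasCount-resp-⇔ : {A : Set} {P Q : A → Set} {n : ℕ} →
    (∀ x → P x ⇔ Q x) → HasCount P n → HasCount Q n
  HasCount-resp-⇔ P⇔Q (xs , uniq , ∈⇔ , len) =
    xs , uniq , (λ x → ⇔.trans (∈⇔ x) (P⇔Q x)) , len

  HasCount-empty : {A : Set} {P : A → Set} → (∀ x → ¬ P x) → HasCount P 0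
  HasCount-empty ¬P = [] , [] , (λ x → mk⇔ (λ ()) (⊥-elim ∘ ¬P x)) , refl

  HasCount-⊎ : {A : Set} {P Q : A → Set} {m n : ℕ} → (∀ x → P x → ¬ Q x) →
    HasCount P m → HasCount Q n → HasCount (λ x → P x ⊎ Q x) (m + n)
  HasCount-⊎ disjoint (xs , uxs , ∈xs⇔ , lenxs) (ys , uys , ∈ys⇔ , lenys) =
    xs ++ ys ,
    Unique.++⁺ uxs uys (λ {x} (∈xs , ∈ys) → disjoint x (to (∈xs⇔ x) ∈xs) (to (∈ys⇔ x) ∈ys)) ,
    (λ x → ⇔.trans ++-∈⇔
      (mk⇔ (Sum.map (to (∈xs⇔ x)) (to (∈ys⇔ x))) (Sum.map (from (∈xs⇔ x)) (from (∈ys⇔ x))))) ,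
    trans (length-++ xs) (cong₂ _+_ lenxs lenys)

  HasCount-Any : {I A : Set} {P : I → A → Set} {f : I → ℕ} →
    (∀ {i j x} → P i x → P j x → i ≡ j) → ∀ {is} → Unique is →
    All (λ i → HasCount (P i) (f i)) is →
    HasCount (λ x → Any (λ i → P i x) is) (sum (map f is))
  HasCount-Any disjoint [] [] = HasCount-empty (λ x ())
  HasCount-Any {P = P} disjoint (i∉is ∷ uniq) (count ∷ counts) =
    HasCount-resp-⇔ (λ x → mk⇔ Any.fromSum Any.toSum)
      (HasCount-⊎ (λ x Pix Pjx → All.lookupAny i∉is Pjx .proj₁ (disjoint Pix (All.lookupAny i∉is Pjx .proj₂)))
        count (HasCount-Any disjoint uniq counts))

  -- Disjointness is asked only for indices up to k: in the odd case the index is recovered from a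
  -- truncated difference σ ∸ i, which determines i only in that range.
  HasCount-∑ : {A : Set} {P : ℕ → A → Set} {f : ℕ → ℕ} (k : ℕ) →
    (∀ {i j x} → i ≤ k → j ≤ k → P i x → P j x → i ≡ j) →
    (∀ i → i ≤ k → HasCount (P i) (f i)) →
    HasCount (λ x → ∃[ i ] i ≤ k × P i x) (sumUpTo k f)
  HasCount-∑ {P = P} {f} k disjoint count =
    HasCount-resp-⇔ (λ x → mk⇔ (toΣ x) (fromΣ x))
      (HasCount-Any (λ (i≤k , Pix) (j≤k , Pjx) → disjoint i≤k j≤k Pix Pjx) (Unique.upTo⁺ (suc k))
        (All.tabulate λ i∈ → bounded _ (s≤s⁻¹ (∈-upTo⁻ i∈))))
    where
    bounded : ∀ i → i ≤ k → HasCount (λ x → i ≤ k × P i x) (f i)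
    bounded i i≤k = HasCount-resp-⇔ (λ x → mk⇔ (i≤k ,_) proj₂) (count i i≤k)
    toΣ : ∀ x → Any (λ i → i ≤ k × P i x) (upTo (suc k)) → ∃[ i ] i ≤ k × P i x
    toΣ x p with i , _ , i≤k , Pix ← find p = i , i≤k , Pix
    fromΣ : ∀ x → ∃[ i ] i ≤ k × P i x → Any (λ i → i ≤ k × P i x) (upTo (suc k))
    fromΣ x (i , i≤k , Pix) = lose (∈-upTo⁺ (s≤s i≤k)) (i≤k , Pix)

  -- Injectivity is needed only on P: the map from words to partitions ignores all letters after the
  -- first m, so it separates only words of the right length.
  HasCount-image : {A B : Set} {P : A → Set} {Q : B → Set} {n : ℕ} (f : A → B) →
    (∀ {x} → P x → Q (f x)) →
    (∀ {x y} → P x → P y → f x ≡ f y → x ≡ y) →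
    (∀ {y} → Q y → ∃[ x ] P x × y ≡ f x) →
    HasCount P n → HasCount Q n
  HasCount-image {A = A} {P = P} {Q = Q} f sound injective surjective (xs , uniq , ∈⇔ , len) =
    map f xs , unique-map uniq (All.tabulate (to (∈⇔ _))) ,
    (λ y → mk⇔ (image⊆Q y) (Q⊆image y)) , trans (length-map f xs) len
    where
    unique-map : ∀ {xs} → Unique xs → All P xs → Unique (map f xs)
    unique-map [] [] = []
    unique-map (x∉xs ∷ uniq) (Px ∷ Pxs) =
      All.map⁺ (All.zipWith (λ (x≢y , Py) → x≢y ∘ injective Px Py) (x∉xs , Pxs))
      ∷ unique-map uniq Pxs
    image⊆Q : ∀ y → y ∈ map f xs → Q y
    image⊆Q y y∈ with x , x∈ , refl ← ∈-map⁻ f y∈ = sound (to (∈⇔ x) x∈)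
    Q⊆image : ∀ y → Q y → y ∈ map f xs
    Q⊆image y Qy with x , Px , refl ← surjective Qy = ∈-map⁺ f (from (∈⇔ x) Px)

-- Words over three letters and multinomial coefficients.

module Words where

  open Counting
  open import Data.Nat.Base using (_+_; _*_; _!)
  open import Data.Nat.DivMod using (m*n/n≡m; /-congˡ)
  open import Data.Nat.Properties using (suc-injective; 0≢1+n; *-zeroˡ; m*n≢0; _!≢0)
  open import Data.Nat.Tactic.RingSolver using (solve-∀)

  data Step : Set where
    up down flat : Step

  ups downs flats : List Step → ℕ
  ups []         = 0
  ups (up ∷ w)   = suc (ups w)
  ups (down ∷ w) = ups w
  ups (flat ∷ w) = ups w
  downs []         = 0
  downs (up ∷ w)   = downs w
  downs (down ∷ w) = suc (downs w)
  downs (flat ∷ w) = downs w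
  flats []         = 0
  flats (up ∷ w)   = flats w
  flats (down ∷ w) = flats w
  flats (flat ∷ w) = suc (flats w)

  HasContent : ℕ → ℕ → ℕ → List Step → Set
  HasContent a b c w = ups w ≡ a × downs w ≡ b × flats w ≡ c

  StartsWith : Step → (List Step → Set) → List Step → Set
  StartsWith x P w = ∃[ v ] w ≡ x ∷ v × P (x ∷ v)

  HasCount-StartsWith : ∀ {P Q : List Step → Set} {n} x →
    (∀ v → P v ⇔ Q (x ∷ v)) → HasCount P n → HasCount (StartsWith x Q) n
  HasCount-StartsWith x P⇔Q = HasCount-image (x ∷_)
    (λ {v} Pv → v , refl , to (P⇔Q v) Pv)
    (λ where _ _ refl → refl)
    (λ where (v , refl , Qxv) → v , from (P⇔Q v) Qxv , refl)

  -- Induction on the first letter, with the quotient cleared of its denominator: the words starting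
  -- with each letter contribute a · k!, b · k! and c · k! to n · a! b! c!, and these add up to (k +
  -- 1)!.
  HasCount-words : ∀ k a b c → a + b + c ≡ k →
    ∃[ n ] HasCount (HasContent a b c) n × n * (a ! * b ! * c !) ≡ k !
  HasCount-words zero zero zero zero refl = 1 , ([] ∷ [] , [] ∷ [] , char , refl) , refl
    where
    char : ∀ w → w ∈ ([] ∷ []) ⇔ HasContent 0 0 0 w
    char []         = mk⇔ (λ _ → refl , refl , refl) (λ _ → here refl)
    char (up ∷ w)   = mk⇔ (λ where (here ()); (there ())) (λ ())
    char (down ∷ w) = mk⇔ (λ where (here ()); (there ())) (λ ())
    char (flat ∷ w) = mk⇔ (λ where (here ()); (there ())) (λ ())
  HasCount-words (suc k) a b c a+b+c≡1+k =
    combine (startUp a b c a+b+c≡1+k) (startDown a b c a+b+c≡1+k) (startFlat a b c a+b+c≡1+k)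
    where
    rearrangeUp : ∀ n a x y z → n * ((suc a * x) * y * z) ≡ suc a * (n * (x * y * z))
    rearrangeUp = solve-∀
    startUp : ∀ a b c → a + b + c ≡ suc k → ∃[ n ] HasCount (StartsWith up (HasContent a b c)) n ×
      n * (a ! * b ! * c !) ≡ a * k !
    startUp zero b c _ = 0 , HasCount-empty (λ where _ (_ , _ , () , _)) , refl
    startUp (suc a) b c eq with n , count , eq′ ← HasCount-words k a b c (suc-injective eq) =
      n , HasCount-StartsWith {Q = HasContent (suc a) b c} up (λ v → mk⇔ (λ where (refl , refl , refl) → refl , refl , refl)
                                            (λ where (refl , refl , refl) → refl , refl , refl)) count ,
      trans (rearrangeUp n a (a !) (b !) (c !)) (cong (suc a *_) eq′)
    shiftDown : ∀ a b c → suc (a + b + c) ≡ a + suc b + c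
    shiftDown = solve-∀
    rearrangeDown : ∀ n b x y z → n * (x * (suc b * y) * z) ≡ suc b * (n * (x * y * z))
    rearrangeDown = solve-∀
    startDown : ∀ a b c → a + b + c ≡ suc k → ∃[ n ] HasCount (StartsWith down (HasContent a b c)) n ×
      n * (a ! * b ! * c !) ≡ b * k !
    startDown a zero c _ = 0 , HasCount-empty (λ where _ (_ , _ , _ , () , _)) , *-zeroˡ (a ! * 1 * c !)
    startDown a (suc b) c eq with n , count , eq′ ← HasCount-words k a b c (suc-injective (trans (shiftDown a b c) eq)) =
      n , HasCount-StartsWith {Q = HasContent a (suc b) c} down (λ v → mk⇔ (λ where (refl , refl , refl) → refl , refl , refl)
                                              (λ where (refl , refl , refl) → refl , refl , refl)) count ,
      trans (rearrangeDown n b (a !) (b !) (c !)) (cong (suc b *_) eq′)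
    shiftFlat : ∀ a b c → suc (a + b + c) ≡ a + b + suc c
    shiftFlat = solve-∀
    rearrangeFlat : ∀ n c x y z → n * (x * y * (suc c * z)) ≡ suc c * (n * (x * y * z))
    rearrangeFlat = solve-∀
    startFlat : ∀ a b c → a + b + c ≡ suc k → ∃[ n ] HasCount (StartsWith flat (HasContent a b c)) n ×
      n * (a ! * b ! * c !) ≡ c * k !
    startFlat a b zero _ = 0 , HasCount-empty (λ where _ (_ , _ , _ , _ , ())) , refl
    startFlat a b (suc c) eq with n , count , eq′ ← HasCount-words k a b c (suc-injective (trans (shiftFlat a b c) eq)) =
      n , HasCount-StartsWith {Q = HasContent a b (suc c)} flat (λ v → mk⇔ (λ where (refl , refl , refl) → refl , refl , refl)
                                              (λ where (refl , refl , refl) → refl , refl , refl)) count ,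
      trans (rearrangeFlat n c (a !) (b !) (c !)) (cong (suc c *_) eq′)
    split : ∀ w → ((StartsWith up (HasContent a b c) w ⊎ StartsWith down (HasContent a b c) w) ⊎
                    StartsWith flat (HasContent a b c) w) ⇔ HasContent a b c w
    split w = mk⇔ join (cut w)
      where
      join : ∀ {w} → ((StartsWith up (HasContent a b c) w ⊎ StartsWith down (HasContent a b c) w) ⊎
                    StartsWith flat (HasContent a b c) w) → HasContent a b c w
      join (inj₁ (inj₁ (_ , refl , p))) = p
      join (inj₁ (inj₂ (_ , refl , p))) = p
      join (inj₂ (_ , refl , p)) = p
      cut : ∀ w → HasContent a b c w → (StartsWith up (HasContent a b c) w ⊎ StartsWith down (HasContent a b c) w) ⊎
                    StartsWith flat (HasContent a b c) w
      cut [] (0≡a , 0≡b , 0≡c) = ⊥-elim (0≢1+n (trans (cong₂ _+_ (cong₂ _+_ 0≡a 0≡b) 0≡c) a+b+c≡1+k))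
      cut (up ∷ w) p   = inj₁ (inj₁ (w , refl , p))
      cut (down ∷ w) p = inj₁ (inj₂ (w , refl , p))
      cut (flat ∷ w) p = inj₂ (w , refl , p)
    combine : (∃[ n ] HasCount (StartsWith up (HasContent a b c)) n × n * (a ! * b ! * c !) ≡ a * k !) →
              (∃[ n ] HasCount (StartsWith down (HasContent a b c)) n × n * (a ! * b ! * c !) ≡ b * k !) →
              (∃[ n ] HasCount (StartsWith flat (HasContent a b c)) n × n * (a ! * b ! * c !) ≡ c * k !) →
              ∃[ n ] HasCount (HasContent a b c) n × n * (a ! * b ! * c !) ≡ suc k !
    combine (n₁ , count₁ , eq₁) (n₂ , count₂ , eq₂) (n₃ , count₃ , eq₃) =
      n₁ + n₂ + n₃ ,
      HasCount-resp-⇔ split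
        (HasCount-⊎ (λ where _ (inj₁ (_ , refl , _)) (_ , () , _); _ (inj₂ (_ , refl , _)) (_ , () , _))
          (HasCount-⊎ (λ where _ (_ , refl , _) (_ , () , _)) count₁ count₂) count₃) ,
      (begin
        (n₁ + n₂ + n₃) * D           ≡⟨ distrib n₁ n₂ n₃ D ⟩
        n₁ * D + n₂ * D + n₃ * D     ≡⟨ cong₂ _+_ (cong₂ _+_ eq₁ eq₂) eq₃ ⟩
        a * k ! + b * k ! + c * k !  ≡⟨ distrib a b c (k !) ⟨
        (a + b + c) * k !            ≡⟨ cong (_* k !) a+b+c≡1+k ⟩
        suc k !                      ∎)
      where
      open ≡-Reasoning
      D : ℕ
      D = a ! * b ! * c !
      distrib : ∀ x y z u → (x + y + z) * u ≡ x * u + y * u + z * u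
      distrib = solve-∀

  HasCount-content : ∀ {n} a b c → a + b + c ≡ n →
    HasCount (HasContent a b c) (multinomial n a b c)
  HasCount-content {n} a b c sum≡n with N , count , N*D≡n! ← HasCount-words n a b c sum≡n =
    subst (HasCount (HasContent a b c)) N≡ count
    where
    instance
      nonZero : NonZero (a ! * b ! * c !)
      nonZero = m*n≢0 (a ! * b !) (c !) {{m*n≢0 (a !) (b !) {{a !≢0}} {{b !≢0}}}} {{c !≢0}}
    N≡ : N ≡ multinomial n a b c
    N≡ = trans (sym (m*n/n≡m N (a ! * b ! * c !))) (/-congˡ N*D≡n!)

-- Young diagrams and the positions of their boundary steps.

module Diagrams where

  open import Data.Integer.Base as ℤ using (ℤ; +_; -[1+_])
  import Data.Integer.Properties as ℤ
  import Data.Integer.Tactic.RingSolver as ℤ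
  open import Data.Nat.Base using (_+_; _∸_; _<_; _>_; _≤_; _≥_)
  open import Data.Nat.Induction using (<-rec)
  open import Data.Nat.Properties
  open import Data.Nat.Tactic.RingSolver using (solve-∀)

  row-suc-≤ : ∀ {p} → Linked _≥_ p → ∀ i → row p (suc i) ≤ row p i
  row-suc-≤ []        i       = z≤n
  row-suc-≤ [-]       i       = z≤n
  row-suc-≤ (x≥y ∷ l) zero    = x≥y
  row-suc-≤ (x≥y ∷ l) (suc i) = row-suc-≤ l i

  row-antitone : ∀ {p} → Linked _≥_ p → ∀ {i j} → i ≤ j → row p j ≤ row p i
  row-antitone {p} l {i} {j} i≤j = subst (λ k → row p k ≤ row p i) (m+[n∸m]≡n i≤j) (go (j ∸ i))
    where
    go : ∀ k → row p (i + k) ≤ row p i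
    go zero    = ≤-reflexive (cong (row p) (+-identityʳ i))
    go (suc k) = ≤-trans (subst (λ n → row p n ≤ row p (i + k)) (sym (+-suc i k)) (row-suc-≤ l (i + k))) (go k)

  row-beyond : ∀ p {i} → length p ≤ i → row p i ≡ 0
  row-beyond []      _       = refl
  row-beyond (x ∷ p) (s≤s l) = row-beyond p l

  row-drop : ∀ k p i → row (drop k p) i ≡ row p (k + i)
  row-drop zero    p       i = refl
  row-drop (suc k) []      i = refl
  row-drop (suc k) (x ∷ p) i = row-drop k p i

  drop-linked : ∀ k {p} → Linked _≥_ p → Linked _≥_ (drop k p)
  drop-linked zero    l       = l
  drop-linked (suc k) []      = []
  drop-linked (suc k) [-]     = drop-linked k []
  drop-linked (suc k) (_ ∷ l) = drop-linked k l

  -- Rows do not increase, so the rows longer than j form an initial segment. This turns the count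
  -- in `leg` into a comparison with a single row.
  <length-filter : ∀ {p} → Linked _≥_ p → ∀ j i → i < length (filter (j <?_) p) ⇔ j < row p i
  <length-filter {[]} l j i = mk⇔ (λ ()) (λ ())
  <length-filter {x ∷ p} l j i with <-≤-connex j x
  <length-filter {x ∷ p} l j zero    | inj₁ j<x rewrite filter-accept (j <?_) {xs = p} j<x = mk⇔ (λ _ → j<x) (λ _ → s≤s z≤n)
  <length-filter {x ∷ p} l j (suc i) | inj₁ j<x rewrite filter-accept (j <?_) {xs = p} j<x =
    mk⇔ (to (<length-filter (Linked.tail l) j i) ∘ s≤s⁻¹) (s≤s ∘ from (<length-filter (Linked.tail l) j i))
  <length-filter {x ∷ p} l j i       | inj₂ x≤j rewrite filter-reject (j <?_) {xs = p} (≤⇒≯ x≤j) =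
    mk⇔ (λ i< → <-≤-trans (to (<length-filter (Linked.tail l) j i) i<) (row-suc-≤ l i))
        (λ j< → ⊥-elim (≤⇒≯ x≤j (<-≤-trans j< (row-antitone l {0} {i} z≤n))))

  ≡-by-< : ∀ {a b} → (∀ k → k < a ⇔ k < b) → a ≡ b
  ≡-by-< {a} {b} eq with <-cmp a b
  ... | tri< a<b _ _ = ⊥-elim (<-irrefl refl (from (eq a) a<b))
  ... | tri≈ _ a≡b _ = a≡b
  ... | tri> _ _ b<a = ⊥-elim (<-irrefl refl (to (eq b) b<a))

  -- Row lengths fail to see only trailing zeros, which positivity of the parts excludes.
  partition-ext : ∀ {p q} → IsPartition p → IsPartition q → (∀ i → row p i ≡ row q i) → p ≡ q
  partition-ext {[]}    {[]}    _ _ _ = refl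
  partition-ext {[]}    {y ∷ q} _ (_ , 0<y ∷ _) eq = ⊥-elim (<-irrefl (eq 0) 0<y)
  partition-ext {x ∷ p} {[]}    (_ , 0<x ∷ _) _ eq = ⊥-elim (<-irrefl (sym (eq 0)) 0<x)
  partition-ext {x ∷ p} {y ∷ q} (lp , _ ∷ pp) (lq , _ ∷ pq) eq =
    cong₂ _∷_ (eq 0) (partition-ext (Linked.tail lp , pp) (Linked.tail lq , pq) (eq ∘ suc))

  -- The positions row p i − i − 1 of the vertical steps on the boundary of the
  -- diagram.
  record Member (p : List ℕ) (x : ℤ) : Set where
    constructor member
    field
      index : ℕ
      row≡  : + row p index ≡ x ℤ.+ + suc index

  -- Conjugation exchanges the vertical and horizontal boundary steps and reverses their order; this
  -- is the induced reflection of positions.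
  opp : ℤ → ℤ
  opp x = ℤ.- (+ 1) ℤ.- x

  opp-+ : ∀ n → opp (+ n) ≡ -[1+ n ]
  opp-+ zero    = refl
  opp-+ (suc n) = refl

  -- Used with t = 0 for a position and its reflection, and with t a prospective hook length, which
  -- x + y + 1 then equals.
  Member-sum : ∀ {a b t} x y i j → + a ≡ x ℤ.+ + suc i → + b ≡ y ℤ.+ + suc j →
    x ℤ.+ y ℤ.+ + 1 ≡ + t → a + b ≡ t + (i + j + 1)
  Member-sum x y i j ea eb e =
    ℤ.+-injective (trans (cong₂ ℤ._+_ ea eb) (trans (regroup x y (+ i) (+ j)) (cong (ℤ._+ (+ (i + j + 1))) e)))
    where
    regroup : ∀ x y i j → (x ℤ.+ (+ 1 ℤ.+ i)) ℤ.+ (y ℤ.+ (+ 1 ℤ.+ j)) ≡ (x ℤ.+ y ℤ.+ + 1) ℤ.+ (i ℤ.+ j ℤ.+ + 1)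
    regroup = ℤ.solve-∀

  -- Hook lengths of a self-conjugate partition as differences of positions.

  module SelfConjugate {p : List ℕ} (part : IsPartition p) (sc : IsSelfConjugate p) where

    -- Column j is as long as row j, and i + 1 of its boxes lie in rows 0 to i; outside the diagram
    -- the difference truncates to 0, as the leg does.
    leg-selfconjugate : ∀ i j → leg p i j ≡ row p j ∸ suc i
    leg-selfconjugate i j = ≡-by-< λ k → ⇔.trans (<length-filter (drop-linked (suc i) (proj₁ part)) j k)
      (mk⇔ (λ j< → m+n≤o⇒m≤o∸n (suc k) (subst (_≤ row p j) (cong suc (+-comm (suc i) k))
                     (to (sc (suc i + k) j) (subst (j <_) (row-drop (suc i) p k) j<))))
           (λ k< → subst (j <_) (sym (row-drop (suc i) p k)) (from (sc (suc i + k) j)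
                     (subst (_< row p j) (+-comm k (suc i)) (m<n∸o⇒m+o<n k<)))))
      where
      m<n∸o⇒m+o<n : ∀ {m n o} → m < n ∸ o → m + o < n
      m<n∸o⇒m+o<n {m} {n} {o} m< = m≤o∸n⇒m+n≤o (suc m) (<⇒≤ (m∸n≢0⇒n<m λ eq → <⇒≱ (subst (m <_) eq m<) z≤n)) m<

    -- If x and y are the positions of rows i and j, this says that the hook length is x + y + 1 = x
    -- - `opp` y: the distance from a member down to a nonmember. The additive form avoids truncated
    -- subtraction.
    hook-selfconjugate : ∀ i j → Box p i j → hook p i j + (i + j + 1) ≡ row p i + row p j
    hook-selfconjugate i j b = begin
      row p i ∸ suc j + leg p i j + 1 + (i + j + 1)          ≡⟨ cong (λ l → row p i ∸ suc j + l + 1 + (i + j + 1)) (leg-selfconjugate i j) ⟩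
      (row p i ∸ suc j) + (row p j ∸ suc i) + 1 + (i + j + 1)  ≡⟨ regroup (row p i ∸ suc j) (row p j ∸ suc i) i j ⟩
      (suc j + (row p i ∸ suc j)) + (suc i + (row p j ∸ suc i)) ≡⟨ cong₂ _+_ (m+[n∸m]≡n b) (m+[n∸m]≡n (to (sc i j) b)) ⟩
      row p i + row p j ∎
      where
      open ≡-Reasoning
      regroup : ∀ a b i j → a + b + 1 + (i + j + 1) ≡ (suc j + a) + (suc i + b)
      regroup = solve-∀

    -- If (i , j) is a box, so is (j , i), and the sum is at least i + j + 2; if neither is a box,
    -- the sum is at most i + j. The value between is skipped.
    row-sum-≢ : ∀ i j → row p i + row p j ≢ i + j + 1
    row-sum-≢ i j eq with j <? row p i
    ... | yes j< = <-irrefl (sym eq) (subst (_≤ row p i + row p j) (regroup i j) (+-mono-≤ j< (to (sc i j) j<)))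
      where
      regroup : ∀ i j → suc j + suc i ≡ suc (i + j + 1)
      regroup = solve-∀
    ... | no j≮ = <-irrefl eq (subst (suc (row p i + row p j) ≤_) (regroup i j)
                    (s≤s (+-mono-≤ (≮⇒≥ j≮) (≮⇒≥ (j≮ ∘ from (sc i j))))))
      where
      regroup : ∀ i j → suc (j + i) ≡ i + j + 1
      regroup = solve-∀

    Member-exclusive : ∀ x → Member p x → ¬ Member p (opp x)
    Member-exclusive x (member i ei) (member j ej) = row-sum-≢ i j (Member-sum x (opp x) i j ei ej (cancel x))
      where
      cancel : ∀ x → x ℤ.+ (ℤ.- (+ 1) ℤ.- x) ℤ.+ + 1 ≡ + 0
      cancel = ℤ.solve-∀

    -- Walk down the rows until the boundary crosses the diagonal j − i = n.
    Member-total-ℕ : ∀ n → Member p (+ n) ⊎ Member p (opp (+ n))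
    Member-total-ℕ n = search (length p) 0 (+-identityʳ _) (λ where _ ())
      where
      search : ∀ fuel i → fuel + i ≡ length p → (∀ i′ → i ≡ suc i′ → n + i < row p i′) →
        Member p (+ n) ⊎ Member p (opp (+ n))
      search fuel i fuel+i above with <-cmp (row p i) (n + suc i)
      search fuel i fuel+i above | tri≈ _ eq _ = inj₁ (member i (cong +_ eq))
      -- Here the boundary meets the diagonal in a horizontal step: column n + i has exactly i
      -- boxes. By symmetry row n + i has length i, and its position is -1 - n.
      search fuel i fuel+i above | tri< row< _ _ = inj₂ (member (n + i) (trans (cong +_ row[n+i]≡i) (shift (+ n) (+ i))))
        where
        shift : ∀ n i → i ≡ ℤ.- (+ 1) ℤ.- n ℤ.+ (+ 1 ℤ.+ (n ℤ.+ i))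
        shift = ℤ.solve-∀
        i≮ : ¬ i < row p (n + i)
        i≮ i< = <⇒≱ (from (sc i (n + i)) i<) (s≤s⁻¹ (subst (row p i <_) (+-suc n i) row<))
        lower : ∀ i → (∀ i′ → i ≡ suc i′ → n + i < row p i′) → i ≤ row p (n + i)
        lower zero    _     = z≤n
        lower (suc i) above = to (sc i (n + suc i)) (above i refl)
        row[n+i]≡i : row p (n + i) ≡ i
        row[n+i]≡i = ≤-antisym (≮⇒≥ i≮) (lower i above)
      search zero       i fuel+i above | tri> _ _ row> =
        ⊥-elim (n≮0 (subst (n + suc i <_) (row-beyond p (≤-reflexive (sym fuel+i))) row>))
      search (suc fuel) i fuel+i above | tri> _ _ row> =
        search fuel (suc i) (trans (+-suc fuel i) fuel+i) (λ where _ refl → row>)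

    Member-total : ∀ x → Member p x ⊎ Member p (opp x)
    Member-total (+ n)     = Member-total-ℕ n
    Member-total -[1+ n ]  =
      Sum.swap (subst (λ y → Member p (+ n) ⊎ Member p y) (opp-+ n) (Member-total-ℕ n))

    Member? : ∀ x → Dec (Member p x)
    Member? x with Member-total x
    ... | inj₁ m = yes m
    ... | inj₂ m = no (λ m′ → Member-exclusive x m′ m)

    -- If x - t were missing, its reflection would be the position of some row j, and the box (i ,
    -- j) would have hook length x - (x - t) = t.
    core⇒closed : ∀ {t} → 0 < t → IsCore t p → ∀ x → Member p x → Member p (x ℤ.- + t)
    core⇒closed {t} 0<t core x (member i ei) with Member-total (x ℤ.- + t)
    ... | inj₁ m = m
    ... | inj₂ (member j ej) = ⊥-elim (core i j box
        (+-cancelʳ-≡ (i + j + 1) (hook p i j) t (trans (hook-selfconjugate i j box) sum≡)))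
      where
      cancel : ∀ x t → x ℤ.+ (ℤ.- (+ 1) ℤ.- (x ℤ.- t)) ℤ.+ + 1 ≡ t
      cancel = ℤ.solve-∀
      sum≡ : row p i + row p j ≡ t + (i + j + 1)
      sum≡ = Member-sum x (opp (x ℤ.- + t)) i j ei ej (cancel x (+ t))
      -- Outside the diagram the row sum would be at most i + j, too small for t + (i + j + 1).
      box : Box p i j
      box with j <? row p i
      ... | yes j< = j<
      ... | no j≮  = ⊥-elim (<⇒≱ (≤-trans (s≤s (+-mono-≤ (≮⇒≥ j≮) (≮⇒≥ (j≮ ∘ from (sc i j)))))
                       (≤-trans (≤-reflexive (regroup i j)) (m≤n+m (i + j + 1) t))) (≤-reflexive (sym sum≡)))
        where
        regroup : ∀ i j → suc (j + i) ≡ i + j + 1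
        regroup = solve-∀

    -- A box of hook length t gives positions x and y of its two rows with x - t = `opp` y; closure
    -- would make both y and its reflection members.
    closed⇒core : ∀ {t} → (∀ x → Member p x → Member p (x ℤ.- + t)) → IsCore t p
    closed⇒core closed i j box refl = Member-exclusive (+ row p i ℤ.- + suc i ℤ.- + hook p i j)
      (closed (+ row p i ℤ.- + suc i) (member i (shift i (+ row p i))))
      (member j (trans (shift j (+ row p j)) (cong (ℤ._+ + suc j) yj≡)))
      where
      open ≡-Reasoning
      shift : ∀ i a → a ≡ a ℤ.- + suc i ℤ.+ + suc i
      shift i a = cancel a (+ suc i)
        where
        cancel : ∀ a b → a ≡ a ℤ.- b ℤ.+ b
        cancel = ℤ.solve-∀
      regroup : ∀ a b i j → b ℤ.- (+ 1 ℤ.+ j) ≡ (a ℤ.+ b) ℤ.- (i ℤ.+ j ℤ.+ + 1) ℤ.- a ℤ.+ i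
      regroup = ℤ.solve-∀
      regroup₂ : ∀ a h i j → h ℤ.+ (i ℤ.+ j ℤ.+ + 1) ℤ.- (i ℤ.+ j ℤ.+ + 1) ℤ.- a ℤ.+ i ≡ ℤ.- (+ 1) ℤ.- (a ℤ.- (+ 1 ℤ.+ i) ℤ.- h)
      regroup₂ = ℤ.solve-∀
      yj≡ : + row p j ℤ.- + suc j ≡ opp (+ row p i ℤ.- + suc i ℤ.- + hook p i j)
      yj≡ = begin
        + row p j ℤ.- + suc j ≡⟨ regroup (+ row p i) (+ row p j) (+ i) (+ j) ⟩
        + (row p i + row p j) ℤ.- + (i + j + 1) ℤ.- + row p i ℤ.+ + i
          ≡⟨ cong (λ r → + r ℤ.- + (i + j + 1) ℤ.- + row p i ℤ.+ + i) (hook-selfconjugate i j box) ⟨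
        + (hook p i j + (i + j + 1)) ℤ.- + (i + j + 1) ℤ.- + row p i ℤ.+ + i ≡⟨ regroup₂ (+ row p i) (+ hook p i j) (+ i) (+ j) ⟩
        opp (+ row p i ℤ.- + suc i ℤ.- + hook p i j) ∎

    Member-bound : ∀ x → Member p x → x ℤ.< + row p 0
    Member-bound x (member i ei) = ℤ.suc[i]≤j⇒i<j (ℤ.≤-trans (ℤ.i≤i+j (+ 1 ℤ.+ x) (+ i))
      (ℤ.≤-trans (ℤ.≤-reflexive (trans (regroup x (+ i)) (sym ei))) (ℤ.+≤+ (row-antitone (proj₁ part) z≤n))))
      where
      regroup : ∀ x i → + 1 ℤ.+ x ℤ.+ i ≡ x ℤ.+ (+ 1 ℤ.+ i)
      regroup = ℤ.solve-∀

  Member⊆⇒row≡ : ∀ {p q} → (∀ x → Member p x → Member q x) → ∀ i → ∃[ j ] row p i + j ≡ row q j + i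
  Member⊆⇒row≡ {p} {q} p⊆q i = fromMember (p⊆q (+ row p i ℤ.- + suc i) (member i (cancel (+ row p i) (+ suc i))))
    where
    cancel : ∀ a b → a ≡ a ℤ.- b ℤ.+ b
    cancel = ℤ.solve-∀
    fromMember : Member q (+ row p i ℤ.- + suc i) → ∃[ j ] row p i + j ≡ row q j + i
    fromMember (member j e) = j , ℤ.+-injective (trans (regroup (+ row p i) (+ i) (+ j)) (cong (ℤ._+ + i) (sym e)))
      where
      regroup : ∀ a i j → a ℤ.+ j ≡ (a ℤ.- (+ 1 ℤ.+ i) ℤ.+ (+ 1 ℤ.+ j)) ℤ.+ i
      regroup = ℤ.solve-∀

  -- Positions strictly decrease down the rows. The position of row i of p occurs in q at some row
  -- j; j < i is impossible, since row j of p already has that position, and for j ≥ i monotonicity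
  -- in q gives the bound.
  row-≤-step : ∀ {p q} → Linked _≥_ p → Linked _≥_ q → (∀ x → Member p x → Member q x) →
    ∀ i → (∀ {k} → k < i → row p k ≡ row q k) → row p i ≤ row q i
  row-≤-step {p} {q} lp lq p⊆q i below with j , e ← Member⊆⇒row≡ {p} {q} p⊆q i with <-≤-connex j i
  ... | inj₁ j<i = ⊥-elim (<-irrefl (trans e (cong (_+ i) (sym (below j<i)))) (+-mono-≤-< (row-antitone lp (<⇒≤ j<i)) j<i))
  ... | inj₂ i≤j = +-cancelʳ-≤ j (row p i) (row q i) (≤-trans (≤-reflexive e) (+-mono-≤ (row-antitone lq i≤j) i≤j))

  Member-injective : ∀ {p q} → IsPartition p → IsPartition q → (∀ x → Member p x ⇔ Member q x) → p ≡ q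
  Member-injective {p} {q} pp pq p⇔q = partition-ext pp pq (<-rec (λ i → row p i ≡ row q i) λ i rec →
    ≤-antisym (row-≤-step (proj₁ pp) (proj₁ pq) (to ∘ p⇔q) i rec)
              (row-≤-step (proj₁ pq) (proj₁ pp) (from ∘ p⇔q) i (sym ∘ rec)))

  -- Rows of p beyond the first n are dropped.
  addColumn : ℕ → List ℕ → List ℕ
  addColumn zero    p       = []
  addColumn (suc n) []      = 1 ∷ addColumn n []
  addColumn (suc n) (x ∷ p) = suc x ∷ addColumn n p

  row-addColumn-< : ∀ n p {i} → i < n → row (addColumn n p) i ≡ suc (row p i)
  row-addColumn-< (suc n) []      {zero}  _         = refl
  row-addColumn-< (suc n) []      {suc i} (s≤s i<n) = row-addColumn-< n [] i<n
  row-addColumn-< (suc n) (x ∷ p) {zero}  _         = refl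
  row-addColumn-< (suc n) (x ∷ p) {suc i} (s≤s i<n) = row-addColumn-< n p i<n

  row-addColumn⁻ : ∀ n p i {j} → j < row (addColumn n p) i → i < n × j < suc (row p i)
  row-addColumn⁻ (suc n) []      zero    j< = s≤s z≤n , j<
  row-addColumn⁻ (suc n) []      (suc i) j< with i< , j<′ ← row-addColumn⁻ n [] i j< = s≤s i< , j<′
  row-addColumn⁻ (suc n) (x ∷ p) zero    j< = s≤s z≤n , j<
  row-addColumn⁻ (suc n) (x ∷ p) (suc i) j< with i< , j<′ ← row-addColumn⁻ n p i j< = s≤s i< , j<′

  addColumn-partition : ∀ n p → IsPartition p → ∀ {x} → row p 0 < x → IsPartition (x ∷ addColumn n p)
  addColumn-partition zero    p       _ 0<x = [-] , ≤-<-trans z≤n 0<x ∷ []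
  addColumn-partition (suc n) []      _ 0<x with l , a ← addColumn-partition n [] ([] , []) {1} (s≤s z≤n) =
    0<x ∷ l , ≤-<-trans z≤n 0<x ∷ a
  addColumn-partition (suc n) (y ∷ p) (l , _ ∷ a) y<x
    with l′ , a′ ← addColumn-partition n p (Linked.tail l , a) {suc y} (s≤s (row-antitone l {0} {1} z≤n)) =
    y<x ∷ l′ , ≤-<-trans z≤n y<x ∷ a′

  -- The self-conjugate partition whose Frobenius symbol has both rows equal to as
  -- (strictly decreasing).
  frobenius : List ℕ → List ℕ
  frobenius []       = []
  frobenius (a ∷ as) = suc a ∷ addColumn a (frobenius as)

  -- By symmetry this also bounds the number of nonempty rows by a, so `addColumn a` drops nothing
  -- from `frobenius as`.
  frobenius-head : ∀ {a as} → Linked _>_ (a ∷ as) → row (frobenius as) 0 ≤ a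
  frobenius-head [-]       = z≤n
  frobenius-head (a>b ∷ _) = a>b

  frobenius-partition : ∀ {as} → Linked _>_ as → IsPartition (frobenius as)
  frobenius-partition {[]}     _ = [] , []
  frobenius-partition {a ∷ as} l =
    addColumn-partition a (frobenius as) (frobenius-partition (Linked.tail l)) (s≤s (frobenius-head l))

  frobenius-symmetric : ∀ {as} → Linked _>_ as → ∀ i j → Box (frobenius as) i j → Box (frobenius as) j i
  frobenius-symmetric {a ∷ as} l zero    zero    b = b
  frobenius-symmetric {a ∷ as} l zero    (suc j) (s≤s j<a) =
    subst (0 <_) (sym (row-addColumn-< a (frobenius as) j<a)) (s≤s z≤n)
  frobenius-symmetric {a ∷ as} l (suc i) zero    b = s≤s (proj₁ (row-addColumn⁻ a (frobenius as) i b))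
  frobenius-symmetric {a ∷ as} l (suc i) (suc j) b
    with i<a , j< ← row-addColumn⁻ a (frobenius as) i b
    with i< ← frobenius-symmetric (Linked.tail l) i j (s≤s⁻¹ j<) =
    subst (suc i <_) (sym (row-addColumn-< a (frobenius as) j<a)) (s≤s i<)
    where
    j<a : j < a
    j<a = <-≤-trans (s≤s⁻¹ j<) (≤-trans (row-antitone (proj₁ (frobenius-partition (Linked.tail l))) z≤n) (frobenius-head l))

  frobenius-selfconjugate : ∀ {as} → Linked _>_ as → IsSelfConjugate (frobenius as)
  frobenius-selfconjugate l i j = mk⇔ (frobenius-symmetric l i j) (frobenius-symmetric l j i)

  -- Lengthening a row by one box and pushing it down by one keeps its position. Thus the rows under
  -- the first keep the positions they have in `frobenius as`, and the first row has position a.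
  frobenius-Member⁻ : ∀ {as} n → Member (frobenius as) (+ n) → n ∈ as
  frobenius-Member⁻ n (member i e) = go _ i (ℤ.+-injective e)
    where
    go : ∀ as i → row (frobenius as) i ≡ n + suc i → n ∈ as
    go []       i       e = ⊥-elim (0≢1+n (trans e (+-suc n i)))
    go (a ∷ as) zero    e = here (sym (suc-injective (trans e (+-comm n 1))))
    go (a ∷ as) (suc i) e = there (go as i (suc-injective (trans (sym (row-addColumn-< a (frobenius as) i<a)) (trans e (+-suc n (suc i))))))
      where
      i<a : i < a
      i<a = proj₁ (row-addColumn⁻ a (frobenius as) i {0} (subst (0 <_) (sym (trans e (+-suc n (suc i)))) (s≤s z≤n)))

  frobenius-Member⁺ : ∀ {as} → Linked _>_ as → ∀ {n} → n ∈ as → Member (frobenius as) (+ n)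
  frobenius-Member⁺ l n∈ = toMember (go l n∈)
    where
    toMember : ∀ {p n} → ∃[ i ] row p i ≡ n + suc i → Member p (+ n)
    toMember (i , e) = member i (cong (λ r → + r) e)
    go : ∀ {as} → Linked _>_ as → ∀ {n} → n ∈ as → ∃[ i ] row (frobenius as) i ≡ n + suc i
    go {a ∷ as} l (here refl) = 0 , +-comm 1 a
    go {a ∷ as} l {n} (there n∈) with i , e ← go (Linked.tail l) n∈ =
      suc i , trans (row-addColumn-< a (frobenius as) i<a) (trans (cong suc e) (sym (+-suc n (suc i))))
      where
      -- Row i of `frobenius as` is nonempty; reflecting its first box into row 0 bounds i by the
      -- length of that row.
      i<a : i < a
      i<a = <-≤-trans (frobenius-symmetric (Linked.tail l) i 0 (subst (0 <_) (sym (trans e (+-suc n i))) (s≤s z≤n))) (frobenius-head l)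

-- Integer inequalities and thresholds of downward closed sets.

module IntegerOrder where

  open import Data.Integer.Base hiding (suc; NonZero)
  open import Data.Integer.Properties
  open import Data.Integer.Tactic.RingSolver using (solve-∀)

  -- Linear arithmetic: the premise d - c ≡ b - a is an identity for the ring solver.
  ≤-from : ∀ {a b c d} → a ≤ b → d - c ≡ b - a → c ≤ d
  ≤-from a≤b e = 0≤i-j⇒j≤i (subst (0ℤ ≤_) (sym e) (i≤j⇒0≤j-i a≤b))

  <-from : ∀ {a b c d} → a < b → d - c ≡ b - a → c < d
  <-from {a} {b} {c} {d} a<b e =
    suc[i]≤j⇒i<j (≤-from (i<j⇒suc[i]≤j a<b) (trans (regroup c d) (trans (cong (_- 1ℤ) e) (sym (regroup a b)))))
    where
    regroup : ∀ c d → d - (+ 1 + c) ≡ d - c - + 1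
    regroup = solve-∀

  <-≤-from : ∀ {a b a′ b′ c d} → a < b → a′ ≤ b′ → d - c ≡ (b - a) + (b′ - a′) → c < d
  <-≤-from {a} {b} {a′} {b′} a<b a′≤b′ e = <-from (+-mono-<-≤ a<b a′≤b′) (trans e (regroup a b a′ b′))
    where
    regroup : ∀ a b a′ b′ → (b - a) + (b′ - a′) ≡ b + b′ - (a + a′)
    regroup = solve-∀

  ≤-≤-from : ∀ {a b a′ b′ c d} → a ≤ b → a′ ≤ b′ → d - c ≡ (b - a) + (b′ - a′) → c ≤ d
  ≤-≤-from {a} {b} {a′} {b′} a≤b a′≤b′ e = ≤-from (+-mono-≤ a≤b a′≤b′) (trans e (regroup a b a′ b′))
    where
    regroup : ∀ a b a′ b′ → (b - a) + (b′ - a′) ≡ b + b′ - (a + a′)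
    regroup = solve-∀

  -- The single value n = a - 1 carries the whole inequality.
  ≤-by-< : ∀ {a b} k → (∀ n → n < a → n - k < b) → a ≤ b + k
  ≤-by-< {a} {b} k h = ≤-from (i<j⇒suc[i]≤j (h (a - + 1) (a-1<a a))) (regroup a b k)
    where
    a-1<a : ∀ n → n - + 1 < n
    a-1<a n = subst (n - + 1 <_) (+-identityʳ n) (+-monoʳ-< n -<+)
    regroup : ∀ a b k → b + k - a ≡ b - (+ 1 + (a - + 1 - k))
    regroup = solve-∀

  ≡-by-< : ∀ {a b} → (∀ n → n < a ⇔ n < b) → a ≡ b
  ≡-by-< {a} {b} h with <-cmp a b
  ... | tri< a<b _ _ = ⊥-elim (<-irrefl refl (from (h a) a<b))
  ... | tri≈ _ a≡b _ = a≡b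
  ... | tri> _ _ b<a = ⊥-elim (<-irrefl refl (to (h b) b<a))

  -- Downward closure puts lo below hi, so an upward search from lo meets its first nonmember within
  -- |hi - lo| steps.
  threshold : ∀ {P : ℤ → Set} → (∀ n → Dec (P n)) → (∀ n → P n → P (n - + 1)) →
    ∀ {lo hi} → P lo → ¬ P hi → ∃[ g ] ∀ n → P n ⇔ n < g
  threshold {P} P? pred-closed {lo} {hi} Plo ¬Phi = search ∣ hi - lo ∣ lo Plo
    (subst (λ z → ¬ P z) (trans (undo hi lo) (cong (λ z → lo + z) (sym (0≤i⇒+∣i∣≡i (i≤j⇒0≤j-i lo≤hi))))) ¬Phi)
    where
    undo : ∀ i j → i ≡ j + (i - j)
    undo = solve-∀
    down-closed-ℕ : ∀ k n → P n → P (n - + k)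
    down-closed-ℕ zero    n p = subst P (sym (+-identityʳ n)) p
    down-closed-ℕ (suc k) n p = subst P (regroup n (+ k)) (pred-closed (n - + k) (down-closed-ℕ k n p))
      where
      regroup : ∀ n k → n - k - + 1 ≡ n - (+ 1 + k)
      regroup = solve-∀
    down-closed : ∀ {i j} → i ≤ j → P j → P i
    down-closed {i} {j} i≤j p = subst P
      (trans (cong (λ z → j - z) (0≤i⇒+∣i∣≡i (i≤j⇒0≤j-i i≤j))) (regroup i j))
      (down-closed-ℕ ∣ j - i ∣ j p)
      where
      regroup : ∀ i j → j - (j - i) ≡ i
      regroup = solve-∀
    lo≤hi : lo ≤ hi
    lo≤hi with lo ≤? hi
    ... | yes l = l
    ... | no ¬l = ⊥-elim (¬Phi (down-closed (<⇒≤ (≰⇒> ¬l)) Plo))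
    search : ∀ k lo → P lo → ¬ P (lo + + k) → ∃[ g ] ∀ n → P n ⇔ n < g
    search zero    lo p ¬p = ⊥-elim (¬p (subst P (sym (+-identityʳ lo)) p))
    search (suc k) lo p ¬p with P? (lo + + 1)
    ... | yes p′ = search k (lo + + 1) p′ (subst (λ z → ¬ P z) (regroup lo (+ k)) ¬p)
      where
      regroup : ∀ lo k → lo + (+ 1 + k) ≡ lo + + 1 + k
      regroup = solve-∀
    ... | no ¬p′ = lo + + 1 , λ n → mk⇔
      (λ Pn → ≰⇒> λ ≤n → ¬p′ (down-closed ≤n Pn))
      (λ n< → down-closed (≤-from (i<j⇒suc[i]≤j n<) (regroup lo n)) p)
      where
      regroup : ∀ lo n → lo - n ≡ lo + + 1 - (+ 1 + n)
      regroup = solve-∀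

-- Words as lattice paths with steps 1, -1 and 0.

module Heights where

  open IntegerOrder
  open Words using (Step; up; down; flat; ups; downs; flats)
  open import Data.Integer.Base hiding (suc; NonZero)
  open import Data.Integer.Properties
  open import Data.Integer.Tactic.RingSolver using (solve-∀)
  import Data.Nat.Base as ℕ
  import Data.Nat.Properties as ℕ

  Close : ℤ → ℤ → Set
  Close i j = i ≤ j + + 1 × j ≤ i + + 1

  Close-refl : ∀ i → Close i i
  Close-refl i = i≤i+j i (+ 1) , i≤i+j i (+ 1)

  value : Step → ℤ
  value up   = + 1
  value down = - (+ 1)
  value flat = + 0

  -- Past the end of the word the path stays level, so consecutive heights are close at every index.
  height : List Step → ℕ → ℤ
  height w       zero    = + 0
  height []      (suc k) = + 0
  height (x ∷ w) (suc k) = value x + height w k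

  -- |d + 2h| ≤ 1 for the final height h.
  IsHalfPath : ℕ → ℕ → List Step → Set
  IsHalfPath d m w = length w ≡ m × Close (height w m) (- + d - height w m)

  height-close : ∀ w k → Close (height w k) (height w (suc k))
  height-close []         zero    = Close-refl (+ 0)
  height-close []         (suc k) = Close-refl (+ 0)
  height-close (up ∷ w)   zero    = +≤+ z≤n , ≤-refl
  height-close (down ∷ w) zero    = ≤-refl , -≤+
  height-close (flat ∷ w) zero    = Close-refl (+ 0)
  height-close (x ∷ w)    (suc k) with a , b ← height-close w k =
    ≤-from a (regroup (value x) (height w k) (height w (suc k))) ,
    ≤-from b (regroup (value x) (height w (suc k)) (height w k))
    where
    regroup : ∀ x i j → x + j + + 1 - (x + i) ≡ j + + 1 - i
    regroup = solve-∀

  value-injective : ∀ {x y} → value x ≡ value y → x ≡ y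
  value-injective {up}   {up}   _ = refl
  value-injective {down} {down} _ = refl
  value-injective {flat} {flat} _ = refl

  height-injective : ∀ v w → length v ≡ length w → (∀ k → k ℕ.≤ length v → height v k ≡ height w k) → v ≡ w
  height-injective []      []      _ _ = refl
  height-injective (x ∷ v) (y ∷ w) l h = cong₂ _∷_ x≡y
    (height-injective v w (ℕ.suc-injective l) λ k k≤ → +-cancelˡ-≡ (value x) _ _
      (trans (h (suc k) (s≤s k≤)) (cong (λ z → value z + height w k) (sym x≡y))))
    where
    +-cancelˡ-≡ : ∀ i j k → i + j ≡ i + k → j ≡ k
    +-cancelˡ-≡ i j k e = trans (undo i j) (trans (cong (_- i) e) (sym (undo i k)))
      where
      undo : ∀ i j → j ≡ i + j - i
      undo = solve-∀
    x≡y : x ≡ y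
    x≡y = value-injective (trans (sym (+-identityʳ (value x))) (trans (h 1 (s≤s z≤n)) (+-identityʳ (value y))))

  stepBetween : ∀ {i j} → Close i j → ∃[ x ] value x ≡ j - i
  stepBetween {i} {j} (i≤j+1 , j≤i+1) =
    small (j - i) (≤-from i≤j+1 (regroup i j)) (≤-from j≤i+1 (regroup′ i j))
    where
    regroup : ∀ i j → j - i - (- (+ 1)) ≡ j + + 1 - i
    regroup = solve-∀
    regroup′ : ∀ i j → + 1 - (j - i) ≡ i + + 1 - j
    regroup′ = solve-∀
    small : ∀ z → - (+ 1) ≤ z → z ≤ + 1 → ∃[ x ] value x ≡ z
    small +0              _        _                = flat , refl
    small +[1+ 0 ]        _        _                = up , refl
    small +[1+ suc n ]    _        (+≤+ (s≤s ()))
    small -[1+ 0 ]        _        _                = down , refl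
    small -[1+ suc n ]    (-≤- ()) _

  wordBetween : ∀ m (g : ℕ → ℤ) → (∀ k → k ℕ.< m → Close (g k) (g (suc k))) →
    ∃[ w ] length w ≡ m × (∀ k → k ℕ.≤ m → height w k ≡ g k - g 0)
  wordBetween zero    g close = [] , refl , λ where zero _ → sym (+-inverseʳ (g 0))
  wordBetween (suc m) g close
    with x , x≡ ← stepBetween (close 0 (s≤s z≤n))
    with w , len , h ← wordBetween m (g ∘ suc) (λ k k<m → close (suc k) (s≤s k<m)) =
    x ∷ w , cong suc len , λ where
      zero    _         → sym (+-inverseʳ (g 0))
      (suc k) (s≤s k≤m) → trans (cong₂ _+_ x≡ (h k k≤m)) (telescope (g 0) (g 1) (g (suc k)))
    where
    telescope : ∀ a b c → b - a + (c - b) ≡ c - a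
    telescope = solve-∀

  length-steps : ∀ w → length w ≡ ups w ℕ.+ downs w ℕ.+ flats w
  length-steps []         = refl
  length-steps (up ∷ w)   = cong suc (length-steps w)
  length-steps (down ∷ w) = trans (cong suc (length-steps w)) (cong (ℕ._+ flats w) (sym (ℕ.+-suc (ups w) (downs w))))
  length-steps (flat ∷ w) = trans (cong suc (length-steps w)) (sym (ℕ.+-suc (ups w ℕ.+ downs w) (flats w)))

  height-length : ∀ w → height w (length w) ≡ + ups w - + downs w
  height-length []         = refl
  height-length (up ∷ w)   = trans (cong (_+_ (+ 1)) (height-length w)) (regroup (+ ups w) (+ downs w))
    where
    regroup : ∀ u v → + 1 + (u - v) ≡ + 1 + u - v
    regroup = solve-∀
  height-length (down ∷ w) = trans (cong (_+_ (- (+ 1))) (height-length w)) (regroup (+ ups w) (+ downs w))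
    where
    regroup : ∀ u v → - (+ 1) + (u - v) ≡ u - (+ 1 + v)
    regroup = solve-∀
  height-length (flat ∷ w) = trans (+-identityˡ (height w (length w))) (height-length w)

  -- The two halves of |d + 2h| ≤ 1 for h = ups - downs, with the subtractions moved across so that
  -- they live in ℕ.
  HasHalfPathCounts : ℕ → ℕ → List Step → Set
  HasHalfPathCounts d m w =
    ups w ℕ.+ downs w ℕ.+ flats w ≡ m ×
    ups w ℕ.+ ups w ℕ.+ d ℕ.≤ downs w ℕ.+ downs w ℕ.+ 1 ×
    downs w ℕ.+ downs w ℕ.≤ ups w ℕ.+ ups w ℕ.+ d ℕ.+ 1

  IsHalfPath⇔ : ∀ {d m} w → IsHalfPath d m w ⇔ HasHalfPathCounts d m w
  IsHalfPath⇔ {d} w = mk⇔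
    (λ where (refl , p , q) → sym (length-steps w) , drop‿+≤+ (≤-from (subst Below p≡ p) (regroup₁ U D (+ d))) ,
                              drop‿+≤+ (≤-from (subst Above p≡ q) (regroup₂ U D (+ d))))
    (λ where (refl , p , q) → length-steps w ,
               subst (λ k → Close (height w k) (- + d - height w k)) (length-steps w)
                 (subst (λ h → Close h (- + d - h)) (sym p≡)
                   (≤-from (+≤+ p) (sym (regroup₁ U D (+ d))) , ≤-from (+≤+ q) (sym (regroup₂ U D (+ d))))))
    where
    U D : ℤ
    U = + ups w
    D = + downs w
    Below Above : ℤ → Set
    Below h = h ≤ - + d - h + + 1
    Above h = - + d - h ≤ h + + 1
    p≡ : height w (length w) ≡ U - D
    p≡ = height-length w
    regroup₁ : ∀ u v d → v + v + + 1 - (u + u + d) ≡ - d - (u - v) + + 1 - (u - v)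
    regroup₁ = solve-∀
    regroup₂ : ∀ u v d → u + u + d + + 1 - (v + v) ≡ u - v + + 1 - (- d - (u - v))
    regroup₂ = solve-∀

-- The lattice of coordinates, profiles, and the bijection between half paths and cores.

module Cores where

  open Counting using (HasCount-image)
  open Diagrams hiding (≡-by-<)
  open Heights
  open IntegerOrder
  open Words using (Step)
  open import Data.Integer.Base hiding (suc; NonZero)
  open import Data.Integer.DivMod using (_/ℕ_; _%ℕ_; n%ℕd<d; a≡a%ℕn+[a/ℕn]*n)
  open import Data.Integer.Properties
  open import Data.Integer.Tactic.RingSolver using (solve-∀)
  import Data.Nat.Base as ℕ
  import Data.Nat.Properties as ℕ

  bézout-ℤ : ∀ {m n} → Coprime m n → ∃[ x ] ∃[ y ] x * + m + y * + n ≡ + 1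
  bézout-ℤ {m} {n} coprime with coprime-Bézout coprime
  ... | Bézout.+- x y eq = + x , - (+ y) , trans (cong (_+ - (+ y) * + n) eq′) (ring (+ y) (+ n))
    where
    eq′ : + x * + m ≡ + 1 + + y * + n
    eq′ = trans (sym (pos-* x m)) (trans (cong (λ z → + z) (sym eq)) (cong (_+_ (+ 1)) (pos-* y n)))
    ring : ∀ y n → + 1 + y * n + - y * n ≡ + 1
    ring = solve-∀
  ... | Bézout.-+ x y eq = - (+ x) , + y , trans (cong (_+_ (- (+ x) * + m)) eq′) (ring (+ x) (+ m))
    where
    eq′ : + y * + n ≡ + 1 + + x * + m
    eq′ = trans (sym (pos-* y n)) (trans (cong (λ z → + z) (sym eq)) (cong (_+_ (+ 1)) (pos-* x m)))
    ring : ∀ x m → - x * m + (+ 1 + x * m) ≡ + 1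
    ring = solve-∀

  -- The constant c is chosen so that x ↦ −1 − x acts on the coordinates of
  -- x = r d + n t + c by (r , n) ↦ (−e − r , −1 − n); replacing (r , n) by
  -- (r + t , n − d) does not change x.
  module Lattice (s d t m e c : ℕ) (0<s : 0 ℕ.< s) (t≡s+d : t ≡ s ℕ.+ d)
    (t≡1+m+m+e : t ≡ suc (m ℕ.+ m) ℕ.+ e) (e≤1 : e ℕ.≤ 1)
    (2c+1≡ : suc (c ℕ.+ c) ≡ e ℕ.* d ℕ.+ t) (coprime : Coprime t d) where

    instance
      t≢0 : NonZero t
      t≢0 = subst NonZero (sym t≡1+m+m+e) _

    1≤t : 1 ℕ.≤ t
    1≤t = ℕ.>-nonZero⁻¹ t

    <t⇒≤ : ∀ {r} → r ℕ.< t → r ℕ.≤ suc (m ℕ.+ m)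
    <t⇒≤ r<t = s≤s⁻¹ (ℕ.≤-trans r<t (ℕ.≤-trans (ℕ.≤-reflexive t≡1+m+m+e)
      (ℕ.≤-trans (ℕ.+-monoʳ-≤ (suc (m ℕ.+ m)) e≤1) (ℕ.≤-reflexive (ℕ.+-comm (suc (m ℕ.+ m)) 1)))))

    opaque
      point : ℕ → ℤ → ℤ
      point r n = + r * + d + n * + t + + c

    centre : + 1 + (+ c + + c) ≡ + e * + d + + t
    centre = trans (cong (λ z → + z) 2c+1≡) (cong (_+ + t) (pos-* e d))

    opaque
      unfolding point

      -- For y = x - c and α t + β d = 1, write y β = r + q t by division; then y = y β d + y α t =
      -- r d + (q d + y α) t.
      coordinates : ∀ x → ∃[ r ] ∃[ n ] r ℕ.< t × x ≡ point r n
      coordinates x = fromBézout (bézout-ℤ coprime)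
        where
        open ≡-Reasoning
        undo : ∀ x c → x ≡ (x - c) * + 1 + c
        undo = solve-∀
        expand : ∀ y α β t d c → y * (α * t + β * d) + c ≡ y * β * d + y * α * t + c
        expand = solve-∀
        collect : ∀ r q t d u c → (r + q * t) * d + u * t + c ≡ r * d + (q * d + u) * t + c
        collect = solve-∀
        combine : ∀ y α β r q → α * + t + β * + d ≡ + 1 → y * β ≡ + r + q * + t →
          y * + 1 + + c ≡ point r (q * + d + y * α)
        combine y α β r q bézout division = begin
          y * + 1 + + c                              ≡⟨ cong (λ u → y * u + + c) bézout ⟨
          y * (α * + t + β * + d) + + c              ≡⟨ expand y α β (+ t) (+ d) (+ c) ⟩
          y * β * + d + y * α * + t + + c            ≡⟨ cong (λ u → u * + d + y * α * + t + + c) division ⟩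
          (+ r + q * + t) * + d + y * α * + t + + c  ≡⟨ collect (+ r) q (+ t) (+ d) (y * α) (+ c) ⟩
          point r (q * + d + y * α)                  ∎
        fromBézout : (∃[ α ] ∃[ β ] α * + t + β * + d ≡ + 1) → ∃[ r ] ∃[ n ] r ℕ.< t × x ≡ point r n
        fromBézout (α , β , bézout) =
          ((x - + c) * β) %ℕ t , ((x - + c) * β) /ℕ t * + d + (x - + c) * α , n%ℕd<d ((x - + c) * β) t ,
          trans (undo x (+ c)) (combine (x - + c) α β (((x - + c) * β) %ℕ t) (((x - + c) * β) /ℕ t) bézout (a≡a%ℕn+[a/ℕn]*n ((x - + c) * β) t))

    opaque
      unfolding point

      point-wrap : ∀ n → point 0 n ≡ point t (n - + d)
      point-wrap n = ring n (+ t) (+ d) (+ c)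
        where
        ring : ∀ n t d c → + 0 * d + n * t + c ≡ t * d + (n - d) * t + c
        ring = solve-∀

      point-unique-≤ : ∀ {r r′ n n′} → r ℕ.≤ r′ → r′ ℕ.≤ t → point r n ≡ point r′ n′ →
        (r ≡ r′ × n ≡ n′) ⊎ (r ≡ 0 × r′ ≡ t × n ≡ n′ + + d)
      point-unique-≤ {r} {r′} {n} {n′} r≤r′ r′≤t eq = conclude (r′ ℕ.∸ r) refl t∣k
        where
        k*d≡ : + (r′ ℕ.∸ r) * + d ≡ (n - n′) * + t
        k*d≡ = begin
          + (r′ ℕ.∸ r) * + d ≡⟨ insert (+ (r′ ℕ.∸ r)) (+ r) (+ d) (n′ * + t + + c) ⟩
          (+ (r ℕ.+ (r′ ℕ.∸ r))) * + d + (n′ * + t + + c) - (+ r * + d + (n′ * + t + + c))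
            ≡⟨ cong (λ u → + u * + d + (n′ * + t + + c) - (+ r * + d + (n′ * + t + + c))) (ℕ.m+[n∸m]≡n r≤r′) ⟩
          + r′ * + d + (n′ * + t + + c) - (+ r * + d + (n′ * + t + + c))
            ≡⟨ cong (_- (+ r * + d + (n′ * + t + + c))) (trans (sym (+-assoc (+ r′ * + d) (n′ * + t) (+ c))) (sym eq)) ⟩
          point r n - (+ r * + d + (n′ * + t + + c)) ≡⟨ cancel (+ r) n n′ (+ d) (+ t) (+ c) ⟩
          (n - n′) * + t ∎
          where
          open ≡-Reasoning
          insert : ∀ k r d z → k * d ≡ (r + k) * d + z - (r * d + z)
          insert = solve-∀
          cancel : ∀ r n n′ d t c → r * d + n * t + c - (r * d + (n′ * t + c)) ≡ (n - n′) * t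
          cancel = solve-∀
        t∣k : t ∣ r′ ℕ.∸ r
        t∣k = coprime-divisor coprime (divides ∣ n - n′ ∣
          (trans (ℕ.*-comm d (r′ ℕ.∸ r)) (trans (cong ∣_∣ (trans (pos-* (r′ ℕ.∸ r) d) k*d≡)) (abs-* (n - n′) (+ t)))))
        conclude : ∀ k → r′ ℕ.∸ r ≡ k → t ∣ r′ ℕ.∸ r → (r ≡ r′ × n ≡ n′) ⊎ (r ≡ 0 × r′ ≡ t × n ≡ n′ + + d)
        conclude zero    k≡ _ = inj₁ (ℕ.≤-antisym r≤r′ (ℕ.m∸n≡0⇒m≤n k≡) , i-j≡0⇒i≡j n n′
          (*-cancelʳ-≡ (n - n′) (+ 0) (+ t) (trans (sym k*d≡) (cong (λ k → + k * + d) k≡))))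
        conclude (suc k) k≡ t∣k = inj₂ (r≡0 , r′≡t , trans (undo n n′) (cong (_+_ n′) (*-cancelʳ-≡ (n - n′) (+ d) (+ t)
            (trans (sym k*d≡) (trans (cong (λ k → + k * + d) (trans (cong (r′ ℕ.∸_) r≡0) r′≡t)) (*-comm (+ t) (+ d)))))))
          where
          undo : ∀ i j → i ≡ j + (i - j)
          undo = solve-∀
          t≤k : t ℕ.≤ r′ ℕ.∸ r
          t≤k = ∣⇒≤ {{subst NonZero (sym k≡) _}} t∣k
          r′≡t : r′ ≡ t
          r′≡t = ℕ.≤-antisym r′≤t (ℕ.≤-trans t≤k (ℕ.m∸n≤m r′ r))
          r≡0 : r ≡ 0
          r≡0 = ℕ.n≤0⇒n≡0 (ℕ.+-cancelʳ-≤ t r 0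
            (ℕ.≤-trans (ℕ.+-monoʳ-≤ r t≤k) (ℕ.≤-trans (ℕ.≤-reflexive (ℕ.m+[n∸m]≡n r≤r′)) r′≤t)))

    -- `symmetry` relates only the columns 0 to 2m + 1 = t - e; when e = 1, column t is governed by
    -- `end` alone.
    record Profile (G : ℕ → ℤ) : Set where
      field
        start    : G 0 ≡ + 0
        end      : G t ≡ - (+ d)
        close    : ∀ r → r ℕ.< t → Close (G r) (G (suc r))
        symmetry : ∀ r r′ → r ℕ.+ r′ ≡ suc (m ℕ.+ m) → G r′ ≡ - (+ d) - G r

    Below : (ℕ → ℤ) → ℤ → Set
    Below G x with r , n , _ ← coordinates x = n < G r

    Below? : ∀ G x → Dec (Below G x)
    Below? G x with r , n , _ ← coordinates x = n <? G r

    opaque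
      unfolding point

      shift-t : ∀ r n → point r n - + t ≡ point r (n - + 1)
      shift-t r n = ring (+ r) n (+ d) (+ t) (+ c)
        where
        ring : ∀ r n d t c → r * d + n * t + c - t ≡ r * d + (n - + 1) * t + c
        ring = solve-∀

      -- Since -s = d - t, the shift moves one column to the right and one level down; likewise -(s
      -- + 2d) = -d - t moves one column to the left.
      shift-s : ∀ r n → point r n - + s ≡ point (suc r) (n - + 1)
      shift-s r n = trans (ring (+ r) n (+ d) (+ s) (+ t) (+ c))
        (trans (cong (λ u → point (suc r) (n - + 1) + (+ u - + (s ℕ.+ d))) t≡s+d)
          (trans (cong (_+_ (point (suc r) (n - + 1))) (+-inverseʳ (+ (s ℕ.+ d)))) (+-identityʳ _)))
        where
        ring : ∀ r n d s t c → r * d + n * t + c - s ≡ (+ 1 + r) * d + (n - + 1) * t + c + (t - (s + d))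
        ring = solve-∀

      shift-s+2d : ∀ r n → point (suc r) n - + (s ℕ.+ 2 ℕ.* d) ≡ point r (n - + 1)
      shift-s+2d r n = trans (cong (λ u → point (suc r) n - (+ s + (+ d + + u))) (ℕ.+-identityʳ d))
        (trans (ring (+ r) n (+ d) (+ s) (+ t) (+ c))
          (trans (cong (λ u → point r (n - + 1) + (+ u - + (s ℕ.+ d))) t≡s+d)
          (trans (cong (_+_ (point r (n - + 1))) (+-inverseʳ (+ (s ℕ.+ d)))) (+-identityʳ _))))
        where
        ring : ∀ r n d s t c → (+ 1 + r) * d + n * t + c - (s + (d + d)) ≡ r * d + (n - + 1) * t + c + (t - (s + d))
        ring = solve-∀

      opp-point : ∀ r r′ n → r ℕ.+ r′ ≡ suc (m ℕ.+ m) → opp (point r n) ≡ point r′ (- (+ 1) - n - + d)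
      opp-point r r′ n r+r′ = general (+ r) (+ r′) n (+ d) (+ t) (+ c) (+ e) centre
        (cong (λ z → + z) (trans t≡1+m+m+e (cong (ℕ._+ e) (sym r+r′))))
        where
        -- The two differences at the end vanish: the first by the choice of c, the second because r
        -- + r′ + e = t.
        expand : ∀ r r′ n d t c e → - (+ 1) - (r * d + n * t + c) ≡
          r′ * d + (- (+ 1) - n - d) * t + c + ((e * d + t) - (+ 1 + (c + c))) + (t - (r + r′ + e)) * d
        expand = solve-∀
        simplify : ∀ z u v d → z + (u - u) + (v - v) * d ≡ z
        simplify = solve-∀
        general : ∀ r r′ n d t c e → + 1 + (c + c) ≡ e * d + t → t ≡ r + r′ + e →
          - (+ 1) - (r * d + n * t + c) ≡ r′ * d + (- (+ 1) - n - d) * t + c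
        general r r′ n d t c e eq₁ eq₂ = trans (expand r r′ n d t c e)
          (trans (cong₂ (λ u v → r′ * d + (- (+ 1) - n - d) * t + c + (e * d + t - u) + (t - v) * d) eq₁ (sym eq₂))
            (simplify (r′ * d + (- (+ 1) - n - d) * t + c) (e * d + t) t d))

    -- `Below` uses one chosen pair of coordinates; the profile makes the choice irrelevant. The
    -- only other pair in range has r = t, where n < -d replaces n + d < 0.
    below-point : ∀ {G} → Profile G → ∀ r n → r ℕ.≤ t → Below G (point r n) ⇔ n < G r
    below-point {G} profile r n r≤t with r′ , n′ , r′<t , eq ← coordinates (point r n) =
      transfer unique
      where
      open Profile profile
      unique : (r ≡ r′ × n ≡ n′) ⊎ (r ≡ 0 × r′ ≡ t × n ≡ n′ + + d) ⊎ (r′ ≡ 0 × r ≡ t × n′ ≡ n + + d)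
      unique with ℕ.≤-total r r′
      ... | inj₁ r≤r′ = Sum.map₂ inj₁ (point-unique-≤ r≤r′ (ℕ.<⇒≤ r′<t) eq)
      ... | inj₂ r′≤r = Sum.map (λ (a , b) → sym a , sym b) inj₂ (point-unique-≤ r′≤r r≤t (sym eq))
      regroup : ∀ n d → - d - n ≡ + 0 - (n + d)
      regroup = solve-∀
      regroup′ : ∀ n d → + 0 - (n + d) ≡ - d - n
      regroup′ = solve-∀
      transfer : (r ≡ r′ × n ≡ n′) ⊎ (r ≡ 0 × r′ ≡ t × n ≡ n′ + + d) ⊎ (r′ ≡ 0 × r ≡ t × n′ ≡ n + + d) →
        n′ < G r′ ⇔ n < G r
      transfer (inj₁ (refl , refl)) = ⇔.refl
      transfer (inj₂ (inj₁ (_ , r′≡t , _))) = ⊥-elim (ℕ.<⇒≢ r′<t r′≡t)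
      transfer (inj₂ (inj₂ (refl , refl , refl))) = mk⇔
        (λ lt → subst (n <_) (sym end) (<-from (subst (n + + d <_) start lt) (regroup n (+ d))))
        (λ lt → subst (n + + d <_) (sym start) (<-from (subst (n <_) end lt) (regroup′ n (+ d))))

    below-coordinates : ∀ G x → ∃[ r ] ∃[ n ] r ℕ.< t × x ≡ point r n × (Below G x ⇔ n < G r)
    below-coordinates G x with r , n , r<t , eq ← coordinates x = r , n , r<t , eq , ⇔.refl

    -- From a profile to a core.

    module FromProfile {G : ℕ → ℤ} (profile : Profile G) where
      open Profile profile

      below⁺ : ∀ {r n} → r ℕ.≤ t → n < G r → Below G (point r n)
      below⁺ {r} {n} r≤t = from (below-point profile r n r≤t)

      n-1<n : ∀ n → n - + 1 < n
      n-1<n n = subst (n - + 1 <_) (+-identityʳ n) (+-monoʳ-< n -<+)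

      shrink : ∀ n a b → n < a → a ≤ b + + 1 → n - + 1 < b
      shrink n a b n<a a≤b+1 = <-≤-from n<a a≤b+1 (regroup n a b)
        where
        regroup : ∀ n a b → b - (n - + 1) ≡ (a - n) + (b + + 1 - a)
        regroup = solve-∀

      below-t : ∀ x → Below G x → Below G (x - + t)
      below-t x b with r , n , r<t , refl , iff ← below-coordinates G x =
        subst (Below G) (sym (shift-t r n)) (below⁺ (ℕ.<⇒≤ r<t) (<-trans (n-1<n n) (to iff b)))

      below-s : ∀ x → Below G x → Below G (x - + s)
      below-s x b with r , n , r<t , refl , iff ← below-coordinates G x =
        subst (Below G) (sym (shift-s r n)) (below⁺ r<t (shrink n (G r) (G (suc r)) (to iff b) (proj₁ (close r r<t))))

      below-s+2d : ∀ x → Below G x → Below G (x - + (s ℕ.+ 2 ℕ.* d))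
      below-s+2d x b with below-coordinates G x
      ... | suc r , n , r<t , refl , iff = subst (Below G) (sym (shift-s+2d r n))
        (below⁺ (ℕ.<⇒≤ (ℕ.<-trans ℕ.≤-refl r<t)) (shrink n (G (suc r)) (G r) (to iff b) (proj₂ (close r (ℕ.<-trans ℕ.≤-refl r<t)))))
      -- Column 0 has no left neighbour: pass to column t, lowering n by d, and from there to column
      -- t - 1.
      ... | zero , n , r<t , refl , iff = subst (Below G) (sym wrapped) (below⁺ ℕ.pred[n]≤n
              (shrink (n - + d) (G t) (G (ℕ.pred t)) n-d<Gt
                (subst (λ u → G u ≤ G (ℕ.pred t) + + 1) (ℕ.suc-pred t) (proj₂ (close (ℕ.pred t) pred[t]<t)))))
        where
        pred[t]<t : ℕ.pred t ℕ.< t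
        pred[t]<t = ℕ.≤-reflexive (ℕ.suc-pred t)
        wrapped : point 0 n - + (s ℕ.+ 2 ℕ.* d) ≡ point (ℕ.pred t) (n - + d - + 1)
        wrapped = trans (cong (_- + (s ℕ.+ 2 ℕ.* d)) (trans (point-wrap n) (cong (λ u → point u (n - + d)) (sym (ℕ.suc-pred t)))))
          (shift-s+2d (ℕ.pred t) (n - + d))
        n-d<Gt : n - + d < G t
        n-d<Gt = subst (n - + d <_) (sym end) (<-from (subst (n <_) start (to iff b)) (regroup n (+ d)))
          where
          regroup : ∀ n d → - d - (n - d) ≡ + 0 - n
          regroup = solve-∀

      -- In the reflected column the condition -1 - n - d < -d - G r says G r ≤ n.
      below-opp : ∀ x → Below G (opp x) ⇔ (¬ Below G x)
      below-opp x with r , n , r<t , refl , iff ← below-coordinates G x =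
        subst (λ y → Below G y ⇔ (¬ Below G (point r n))) (sym (opp-point r r′ n r+r′))
          (⇔.trans (below-point profile r′ (- (+ 1) - n - + d) r′≤t)
            (mk⇔ (λ lt b → ≤⇒≯ (≤-from (i<j⇒suc[i]≤j (subst (- (+ 1) - n - + d <_) (symmetry r r′ r+r′) lt)) (regroup n (G r) (+ d))) (to iff b))
                 (λ ¬b → subst (- (+ 1) - n - + d <_) (sym (symmetry r r′ r+r′))
                    (suc[i]≤j⇒i<j (≤-from (≮⇒≥ (¬b ∘ from iff)) (regroup′ n (G r) (+ d)))))))
        where
        r′ : ℕ
        r′ = suc (m ℕ.+ m) ℕ.∸ r
        r+r′ : r ℕ.+ r′ ≡ suc (m ℕ.+ m)
        r+r′ = ℕ.m+[n∸m]≡n (<t⇒≤ r<t)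
        r′≤t : r′ ℕ.≤ t
        r′≤t = ℕ.≤-trans (ℕ.m∸n≤m _ r) (ℕ.≤-trans (ℕ.m≤m+n _ e) (ℕ.≤-reflexive (sym t≡1+m+m+e)))
        regroup : ∀ n g d → n - g ≡ (- d - g) - (+ 1 + (- (+ 1) - n - d))
        regroup = solve-∀
        regroup′ : ∀ n g d → (- d - g) - (+ 1 + (- (+ 1) - n - d)) ≡ n - g
        regroup′ = solve-∀

      profile-≤ : ∀ r → r ℕ.≤ t → G r ≤ + r
      profile-≤ zero    _   = ≤-reflexive start
      profile-≤ (suc r) r<t = ≤-≤-from (proj₂ (close r r<t)) (profile-≤ r (ℕ.<⇒≤ r<t)) (regroup (+ r) (G r) (G (suc r)))
        where
        regroup : ∀ r g g′ → + 1 + r - g′ ≡ (g + + 1 - g′) + (r - g)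
        regroup = solve-∀

    -- Dominates every point below a profile, as r ≤ t and n < G r ≤ r ≤ t; it makes the search for
    -- nonnegative elements finite.
    bound : ℕ
    bound = t ℕ.* d ℕ.+ t ℕ.* t ℕ.+ c

    opaque
      unfolding point

      below-bound : ∀ {G} → Profile G → ∀ x → Below G x → x ≤ + bound
      below-bound {G} profile x b with r , n , r<t , refl , iff ← below-coordinates G x =
        subst (point r n ≤_) (cong₂ (λ u v → u + v + + c) (sym (pos-* t d)) (sym (pos-* t t)))
          (+-monoˡ-≤ (+ c) (+-mono-≤ (*-monoʳ-≤-nonNeg (+ d) (+≤+ (ℕ.<⇒≤ r<t)))
            (*-monoʳ-≤-nonNeg (+ t) (<⇒≤ (<-≤-trans (to iff b) (≤-trans (FromProfile.profile-≤ profile r (ℕ.<⇒≤ r<t)) (+≤+ (ℕ.<⇒≤ r<t))))))))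

    diagonal : (ℕ → ℤ) → List ℕ
    diagonal G = filter (λ a → Below? G (+ a)) (downFrom (suc bound))

    diagonal-decreasing : ∀ G → Linked ℕ._>_ (diagonal G)
    diagonal-decreasing G = AllPairs⇒Linked (AllPairs.filter⁺ (λ a → Below? G (+ a))
      (AllPairs.applyDownFrom⁺₁ (λ a → a) (suc bound) (λ j<i _ → j<i)))

    corePartition : (ℕ → ℤ) → List ℕ
    corePartition G = frobenius (diagonal G)

    corePartition-partition : ∀ G → IsPartition (corePartition G)
    corePartition-partition G = frobenius-partition (diagonal-decreasing G)

    corePartition-selfconjugate : ∀ G → IsSelfConjugate (corePartition G)
    corePartition-selfconjugate G = frobenius-selfconjugate (diagonal-decreasing G)

    -- The Frobenius symbol settles the nonnegative integers. Both sets contain exactly one of x and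
    -- -1 - x, so they agree on the negative ones too.
    corePartition-Member : ∀ {G} → Profile G → ∀ x → Member (corePartition G) x ⇔ Below G x
    corePartition-Member {G} profile = char
      where
      open SelfConjugate (corePartition-partition G) (corePartition-selfconjugate G)
      open FromProfile profile
      char-ℕ : ∀ n → Member (corePartition G) (+ n) ⇔ Below G (+ n)
      char-ℕ n = mk⇔
        (λ mem → proj₂ (∈-filter⁻ (λ a → Below? G (+ a)) {xs = downFrom (suc bound)} (frobenius-Member⁻ {diagonal G} n mem)))
        (λ b → frobenius-Member⁺ (diagonal-decreasing G)
          (∈-filter⁺ (λ a → Below? G (+ a)) (∈-downFrom⁺ (s≤s (drop‿+≤+ (below-bound profile (+ n) b)))) b))
      char : ∀ x → Member (corePartition G) x ⇔ Below G x
      char (+ n)    = char-ℕ n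
      char -[1+ n ] = subst (λ x → Member (corePartition G) x ⇔ Below G x) (opp-+ n) (mk⇔
        (λ mem → from (below-opp (+ n)) λ b → Member-exclusive (+ n) (from (char-ℕ n) b) mem)
        (λ b → Sum.fromInj₂ (λ mem → ⊥-elim (to (below-opp (+ n)) b (to (char-ℕ n) mem))) (Member-total (+ n))))

    IsSelfConjugateCore : List ℕ → Set
    IsSelfConjugateCore = IsSelfConjugateCorePartition (s ∷ s ℕ.+ d ∷ s ℕ.+ 2 ℕ.* d ∷ [])

    corePartition-core : ∀ {G} → Profile G → IsSelfConjugateCore (corePartition G)
    corePartition-core {G} profile = corePartition-partition G , corePartition-selfconjugate G ,
      core s below-s ∷
      core (s ℕ.+ d) (subst (λ u → ∀ x → Below G x → Below G (x - + u)) t≡s+d below-t) ∷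
      core (s ℕ.+ 2 ℕ.* d) below-s+2d ∷ []
      where
      open SelfConjugate (corePartition-partition G) (corePartition-selfconjugate G)
      open FromProfile profile
      core : ∀ u → (∀ x → Below G x → Below G (x - + u)) → IsCore u (corePartition G)
      core u closed = closed⇒core λ x mem →
        from (corePartition-Member profile (x - + u)) (closed x (to (corePartition-Member profile x) mem))

    opaque
      unfolding point

      -- The level n = -1 - (r d + c + R) satisfies n t ≤ n because t ≥ 1, so the point is at most
      -- -1 - R. With R the first row, its reflection exceeds every member, and the point itself is
      -- a member.
      point-low : ∀ r R → + R ≤ opp (point r -[1+ r ℕ.* d ℕ.+ c ℕ.+ R ])
      point-low r R = ≤-from z*t≤z (trans (regroup (+ r * + d) (z * + t) (+ R) (+ c)) (cong (_- (z * + t)) (sym z≡)))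
        where
        z : ℤ
        z = -[1+ r ℕ.* d ℕ.+ c ℕ.+ R ]
        z≡ : z ≡ - (+ 1) - (+ r * + d + + c + + R)
        z≡ = trans (cong (λ u → - (+ 1 + (u + + c + + R))) (pos-* r d)) (neg-distrib-+ (+ 1) (+ r * + d + + c + + R))
        z*t≤z : z * + t ≤ z
        z*t≤z = subst (z * + t ≤_) (*-identityʳ z) (*-monoˡ-≤-nonPos z (+≤+ 1≤t))
        regroup : ∀ u v R c → - (+ 1) - (u + v + c) - R ≡ - (+ 1) - (u + c + R) - v
        regroup = solve-∀

      point-high : ∀ r R → + R ≤ point r (+ R)
      point-high r R = subst (+ R ≤_) (cong₂ (λ u v → u + v + + c) (pos-* r d) (pos-* R t))
        (+≤+ (ℕ.≤-trans (ℕ.m≤m*n R t) (ℕ.≤-trans (ℕ.m≤n+m (R ℕ.* t) (r ℕ.* d)) (ℕ.m≤m+n _ c))))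

    -- From a core to its profile.

    module FromPartition {p : List ℕ} (core : IsSelfConjugateCore p) where
      open SelfConjugate (proj₁ core) (proj₁ (proj₂ core))

      closed-s : ∀ x → Member p x → Member p (x - + s)
      closed-s with s-core ∷ _ ← proj₂ (proj₂ core) = core⇒closed 0<s s-core

      closed-t : ∀ x → Member p x → Member p (x - + t)
      closed-t with _ ∷ t-core ∷ _ ← proj₂ (proj₂ core) =
        core⇒closed 1≤t (subst (λ u → IsCore u p) (sym t≡s+d) t-core)

      closed-s+2d : ∀ x → Member p x → Member p (x - + (s ℕ.+ 2 ℕ.* d))
      closed-s+2d with _ ∷ _ ∷ s+2d-core ∷ [] ← proj₂ (proj₂ core) = core⇒closed (ℕ.≤-trans 0<s (ℕ.m≤m+n s _)) s+2d-core

      low : ∀ r → Member p (point r -[1+ r ℕ.* d ℕ.+ c ℕ.+ row p 0 ])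
      low r = Sum.fromInj₁ (λ mem → ⊥-elim (<⇒≱ (Member-bound _ mem) (point-low r (row p 0)))) (Member-total _)

      high : ∀ r → ¬ Member p (point r (+ row p 0))
      high r mem = <⇒≱ (Member-bound _ mem) (point-high r (row p 0))

      exists : ∀ r → ∃[ g ] ∀ n → Member p (point r n) ⇔ n < g
      exists r = threshold (λ n → Member? (point r n))
        (λ n mem → subst (Member p) (shift-t r n) (closed-t _ mem)) (low r) (high r)

      level : ℕ → ℤ
      level r = proj₁ (exists r)

      Member⇔<level : ∀ r n → Member p (point r n) ⇔ n < level r
      Member⇔<level r = proj₂ (exists r)

      level-close : ∀ r → Close (level r) (level (suc r))
      level-close r =
        ≤-by-< (+ 1) (λ n n< → to (Member⇔<level (suc r) (n - + 1))
          (subst (Member p) (shift-s r n) (closed-s _ (from (Member⇔<level r n) n<)))) ,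
        ≤-by-< (+ 1) (λ n n< → to (Member⇔<level r (n - + 1))
          (subst (Member p) (shift-s+2d r n) (closed-s+2d _ (from (Member⇔<level (suc r) n) n<))))

      level-end : level t ≡ level 0 - + d
      level-end = ≤-antisym
        (≤-by-< (- + d) λ n n< → to (Member⇔<level 0 (n - - + d)) (subst (Member p)
          (sym (trans (point-wrap (n - - + d)) (cong (point t) (undo n (+ d))))) (from (Member⇔<level t n) n<)))
        (≤-from (≤-by-< (+ d) λ n n< → to (Member⇔<level t (n - + d)) (subst (Member p) (point-wrap n)
            (from (Member⇔<level 0 n) n<))) (regroup (level 0) (level t) (+ d)))
        where
        undo : ∀ n d → n - - d - d ≡ n
        undo = solve-∀
        regroup : ∀ a b d → b - (a - d) ≡ b + d - a
        regroup = solve-∀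

      level-symmetry : ∀ r r′ → r ℕ.+ r′ ≡ suc (m ℕ.+ m) → level r′ ≡ - + d - level r
      level-symmetry r r′ r+r′ = ≡-by-< λ n → mk⇔
        (λ n< → suc[i]≤j⇒i<j (≤-from (≮⇒≥ λ lt → Member-exclusive _ (from (Member⇔<level r _) lt)
           (subst (Member p) (sym (opposite n)) (from (Member⇔<level r′ n) n<))) (regroup n (level r) (+ d))))
        (λ n< → to (Member⇔<level r′ n) (subst (Member p) (opposite n)
           (Sum.fromInj₂ (λ mem → ⊥-elim (<⇒≱ (to (Member⇔<level r _) mem) (≤-from (i<j⇒suc[i]≤j n<) (regroup′ n (level r) (+ d)))))
             (Member-total (point r (- (+ 1) - n - + d))))))
        where
        opposite : ∀ n → opp (point r (- (+ 1) - n - + d)) ≡ point r′ n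
        opposite n = trans (opp-point r r′ _ r+r′) (cong (point r′) (undo n (+ d)))
          where
          undo : ∀ n d → - (+ 1) - (- (+ 1) - n - d) - d ≡ n
          undo = solve-∀
        regroup : ∀ n g d → - d - g - (+ 1 + n) ≡ - (+ 1) - n - d - g
        regroup = solve-∀
        regroup′ : ∀ n g d → - (+ 1) - n - d - g ≡ - d - g - (+ 1 + n)
        regroup′ = solve-∀

      -- Column 2m + 1 has level -d - level 0 by symmetry, and column t has level 0 - d by the
      -- identification of columns 0 and t. They are at most one step apart, so |2 · level 0| ≤ 1,
      -- and parity leaves only 0.
      level-start : level 0 ≡ + 0
      level-start = halve (level 0)
          (≤-from (proj₂ near) (regroup (level 0) (+ d))) (≤-from (proj₁ near) (regroup′ (level 0) (+ d)))
        where
        step : ∀ e → e ℕ.≤ 1 → ∀ r → Close (level r) (level (r ℕ.+ e))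
        step zero    _         r = subst (λ u → Close (level r) (level u)) (sym (ℕ.+-identityʳ r)) (Close-refl (level r))
        step (suc zero) _      r = subst (λ u → Close (level r) (level u)) (ℕ.+-comm 1 r) (level-close r)
        step (suc (suc _)) (s≤s ()) r
        near : Close (- + d - level 0) (level 0 - + d)
        near = subst₂ Close (level-symmetry 0 (suc (m ℕ.+ m)) refl) (trans (cong level (sym t≡1+m+m+e)) level-end)
          (step e e≤1 (suc (m ℕ.+ m)))
        regroup : ∀ z d → + 1 - (z + z) ≡ - d - z + + 1 - (z - d)
        regroup = solve-∀
        regroup′ : ∀ z d → z + z - - (+ 1) ≡ z - d + + 1 - (- d - z)
        regroup′ = solve-∀
        halve : ∀ z → z + z ≤ + 1 → - (+ 1) ≤ z + z → z ≡ + 0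
        halve +0       _ _ = refl
        halve +[1+ n ] (+≤+ (s≤s le)) _ with () ← ℕ.n≤0⇒n≡0 (ℕ.≤-trans (ℕ.≤-reflexive (sym (ℕ.+-suc n n))) le)
        halve -[1+ n ] _ (-≤- ())

    -- Half paths as the first halves of profiles.

    wordProfile : List Step → ℕ → ℤ
    wordProfile w r with r ℕ.≤? m
    ... | yes _ = height w r
    ... | no  _ = - + d - height w (suc (m ℕ.+ m) ℕ.∸ r)

    wordProfile-≤ : ∀ w {r} → r ℕ.≤ m → wordProfile w r ≡ height w r
    wordProfile-≤ w {r} r≤m with r ℕ.≤? m
    ... | yes _ = refl
    ... | no r≰m = ⊥-elim (r≰m r≤m)

    wordProfile-> : ∀ w {r} → m ℕ.< r → wordProfile w r ≡ - + d - height w (suc (m ℕ.+ m) ℕ.∸ r)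
    wordProfile-> w {r} m<r with r ℕ.≤? m
    ... | yes r≤m = ⊥-elim (ℕ.<⇒≱ m<r r≤m)
    ... | no _ = refl

    Close-reflect : ∀ {i j} k → Close j i → Close (k - i) (k - j)
    Close-reflect {i} {j} k (j≤ , i≤) = ≤-from j≤ (regroup k i j) , ≤-from i≤ (regroup k j i)
      where
      regroup : ∀ k i j → k - j + + 1 - (k - i) ≡ i + + 1 - j
      regroup = solve-∀

    -- Once r reaches k the truncated index stays at 0; this supplies the flat last step of the
    -- profile when t is even.
    height-∸-close : ∀ w k r → Close (height w (k ℕ.∸ suc r)) (height w (k ℕ.∸ r))
    height-∸-close w zero    r       = subst (λ u → Close (+ 0) (height w u)) (sym (ℕ.0∸n≡0 r)) (Close-refl (+ 0))
    height-∸-close w (suc k) zero    = height-close w k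
    height-∸-close w (suc k) (suc r) = height-∸-close w k r

    wordProfile-profile : ∀ {w} → IsHalfPath d m w → Profile (wordProfile w)
    wordProfile-profile {w} (len , near) = record
      { start = wordProfile-≤ w z≤n
      -- For e = 0 and for e = 1 the index 2m + 1 ∸ t is 0, so the reflected height is -d.
      ; end = trans (wordProfile-> w (subst (m ℕ.<_) (sym t≡1+m+m+e) (s≤s (ℕ.≤-trans (ℕ.m≤m+n m m) (ℕ.m≤m+n (m ℕ.+ m) e)))))
                (trans (cong (λ u → - + d - height w u) (ℕ.m≤n⇒m∸n≡0 (ℕ.≤-trans (ℕ.m≤m+n (suc (m ℕ.+ m)) e) (ℕ.≤-reflexive (sym t≡1+m+m+e)))))
                   (+-identityʳ (- + d)))
      ; close = λ r _ → closeness r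
      ; symmetry = sym-cases
      }
      where
      closeness : ∀ r → Close (wordProfile w r) (wordProfile w (suc r))
      closeness r with ℕ.<-cmp r m
      ... | tri< r<m _ _ = subst₂ Close (sym (wordProfile-≤ w (ℕ.<⇒≤ r<m))) (sym (wordProfile-≤ w r<m)) (height-close w r)
      -- The middle step joins the final height to its own reflection: this is exactly the half-path
      -- condition.
      ... | tri≈ _ refl _ = subst₂ Close (sym (wordProfile-≤ w {m} ℕ.≤-refl))
              (sym (trans (wordProfile-> w {suc m} ℕ.≤-refl) (cong (λ u → - + d - height w u) (ℕ.m+n∸m≡n m m)))) near
      ... | tri> _ _ r>m = subst₂ Close (sym (wordProfile-> w r>m)) (sym (wordProfile-> w (ℕ.m<n⇒m<1+n r>m)))
              (Close-reflect (- + d) (height-∸-close w (suc (m ℕ.+ m)) r))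
      sym-cases : ∀ r r′ → r ℕ.+ r′ ≡ suc (m ℕ.+ m) → wordProfile w r′ ≡ - + d - wordProfile w r
      sym-cases r r′ r+r′ with r ℕ.≤? m
      ... | yes r≤m = trans (wordProfile-> w m<r′) (cong (λ u → - + d - height w u)
              (trans (cong (ℕ._∸ r′) (sym r+r′)) (ℕ.m+n∸n≡m r r′)))
        where
        m<r′ : m ℕ.< r′
        m<r′ = ℕ.+-cancelˡ-≤ m (suc m) r′ (ℕ.≤-trans (ℕ.≤-reflexive (trans (ℕ.+-suc m m) (sym r+r′))) (ℕ.+-monoˡ-≤ r′ r≤m))
      ... | no r≰m = trans (wordProfile-≤ w r′≤m) (trans (undo (+ d) (height w r′))
              (cong (λ u → - + d - (- + d - height w u)) (sym (trans (cong (ℕ._∸ r) (sym r+r′)) (ℕ.m+n∸m≡n r r′)))))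
        where
        undo : ∀ d h → h ≡ - d - (- d - h)
        undo = solve-∀
        r′≤m : r′ ℕ.≤ m
        r′≤m = ℕ.+-cancelˡ-≤ (suc m) r′ m (ℕ.≤-trans (ℕ.+-monoˡ-≤ r′ (ℕ.≰⇒> r≰m)) (ℕ.≤-reflexive r+r′))

    fromWord : List Step → List ℕ
    fromWord w = corePartition (wordProfile w)

    -- The partition determines its set of positions, the set its thresholds, and the thresholds of
    -- columns 0 to m are the heights of the word.
    fromWord-injective : ∀ {v w} → IsHalfPath d m v → IsHalfPath d m w → fromWord v ≡ fromWord w → v ≡ w
    fromWord-injective {v} {w} hv@(lenv , _) hw@(lenw , _) eq = height-injective v w (trans lenv (sym lenw)) λ k k≤ →
      let k≤m = ℕ.≤-trans k≤ (ℕ.≤-reflexive lenv) in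
      trans (sym (wordProfile-≤ v k≤m)) (trans (same k (ℕ.≤-trans k≤m m≤t)) (wordProfile-≤ w k≤m))
      where
      m≤t : m ℕ.≤ t
      m≤t = ℕ.≤-trans (ℕ.≤-trans (ℕ.m≤m+n m m) (ℕ.≤-trans (ℕ.n≤1+n (m ℕ.+ m)) (ℕ.m≤m+n _ e))) (ℕ.≤-reflexive (sym t≡1+m+m+e))
      same : ∀ r → r ℕ.≤ t → wordProfile v r ≡ wordProfile w r
      same r r≤t = ≡-by-< λ n →
        ⇔.trans (⇔.sym (below-point (wordProfile-profile hv) r n r≤t))
          (⇔.trans (⇔.sym (corePartition-Member (wordProfile-profile hv) (point r n)))
            (⇔.trans (subst (λ q → Member (fromWord v) (point r n) ⇔ Member q (point r n)) eq ⇔.refl)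
              (⇔.trans (corePartition-Member (wordProfile-profile hw) (point r n))
                (below-point (wordProfile-profile hw) r n r≤t))))

    fromWord-surjective : ∀ {p} → IsSelfConjugateCore p → ∃[ w ] IsHalfPath d m w × p ≡ fromWord w
    fromWord-surjective {p} core = build (wordBetween m level (λ k _ → level-close k))
      where
      open FromPartition core
      build : (∃[ w ] length w ≡ m × (∀ k → k ℕ.≤ m → height w k ≡ level k - level 0)) →
        ∃[ w ] IsHalfPath d m w × p ≡ fromWord w
      build (w , len , h) = w , half , Member-injective (proj₁ core) (corePartition-partition (wordProfile w)) same-members
        where
        height≡level : ∀ k → k ℕ.≤ m → height w k ≡ level k
        height≡level k k≤m = trans (h k k≤m) (trans (cong (λ u → level k - u) level-start) (+-identityʳ (level k)))
        -- Symmetry gives level (m + 1) = -d - level m, so closeness of these two levels is the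
        -- required condition.
        half : IsHalfPath d m w
        half = len , subst₂ Close (sym (height≡level m ℕ.≤-refl))
          (trans (level-symmetry m (suc m) (ℕ.+-suc m m)) (cong (λ u → - + d - u) (sym (height≡level m ℕ.≤-refl))))
          (level-close m)
        profile : Profile (wordProfile w)
        profile = wordProfile-profile half
        -- Only columns up to m are matched by the word; beyond m both sides are the same
        -- reflection. The range covers all columns below t because e ≤ 1.
        agree : ∀ r → r ℕ.≤ suc (m ℕ.+ m) → level r ≡ wordProfile w r
        agree r r≤ with ℕ.≤-<-connex r m
        ... | inj₁ r≤m = sym (trans (wordProfile-≤ w r≤m) (height≡level r r≤m))
        ... | inj₂ m<r = trans (level-symmetry r′ r (ℕ.m∸n+n≡m r≤)) (trans
                (cong (λ u → - + d - u) (sym (trans (wordProfile-≤ w r′≤m) (height≡level r′ r′≤m))))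
                (sym (Profile.symmetry profile r′ r (ℕ.m∸n+n≡m r≤))))
          where
          r′ : ℕ
          r′ = suc (m ℕ.+ m) ℕ.∸ r
          r′≤m : r′ ℕ.≤ m
          r′≤m = ℕ.≤-trans (ℕ.∸-monoʳ-≤ (suc (m ℕ.+ m)) m<r) (ℕ.≤-reflexive (ℕ.m+n∸m≡n m m))
        same-members : ∀ x → Member p x ⇔ Member (fromWord w) x
        same-members x with r , n , r<t , refl , iff ← below-coordinates (wordProfile w) x =
          ⇔.trans (Member⇔<level r n) (⇔.trans
            (subst (λ u → n < level r ⇔ n < u) (agree r (<t⇒≤ r<t)) ⇔.refl)
            (⇔.trans (⇔.sym iff) (⇔.sym (corePartition-Member profile (point r n)))))

    HasCount-cores : ∀ {N} → HasCount (IsHalfPath d m) N → HasCount IsSelfConjugateCore N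
    HasCount-cores = HasCount-image fromWord (corePartition-core ∘ wordProfile-profile)
      fromWord-injective fromWord-surjective

-- Counting half paths by the numbers of their steps.

module HalfPaths where

  open Counting
  open Heights using (IsHalfPath; HasHalfPathCounts; IsHalfPath⇔)
  open Words
  open import Data.Nat.Base using (_+_; _*_; _∸_; _<_; _≤_)
  open import Data.Nat.DivMod
  open import Data.Nat.Properties
  open import Data.Nat.Tactic.RingSolver using (solve-∀)

  halve : ∀ n → ∃[ k ] (n ≡ k + k ⊎ n ≡ suc (k + k))
  halve zero    = 0 , inj₁ refl
  halve (suc n) with halve n
  ... | k , inj₁ refl = k , inj₂ refl
  ... | k , inj₂ refl = suc k , inj₁ (cong suc (sym (+-suc k k)))

  half-even : ∀ k → (k + k) / 2 ≡ k
  half-even k = trans (cong (_/ 2) (regroup k)) (m*n/n≡m k 2)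
    where
    regroup : ∀ k → k + k ≡ k * 2
    regroup = solve-∀

  half-odd : ∀ k → suc (k + k) / 2 ≡ k
  half-odd k = trans (+-distrib-/-∣ʳ 1 (divides k (regroup k))) (half-even k)
    where
    regroup : ∀ k → k + k ≡ k * 2
    regroup = solve-∀

  double-cancel-≤ : ∀ {a b} → a + a ≤ b + b + 1 → a ≤ b
  double-cancel-≤ {a} {b} le with ≤-<-connex a b
  ... | inj₁ a≤b = a≤b
  ... | inj₂ b<a = ⊥-elim (<-irrefl refl (≤-trans (≤-reflexive (regroup b)) (≤-trans (+-mono-≤ b<a b<a) le)))
    where
    regroup : ∀ b → suc (b + b + 1) ≡ suc b + suc b
    regroup = solve-∀

  -- For d = 2δ parity turns |d + 2h| ≤ 1 into h = -δ, so downs = δ + ups, and i is the number of up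
  -- steps. With s = 2σ + 1 the range i ≤ s / 4 is the same as 2i ≤ σ, which keeps the number of
  -- flat steps from truncating.
  HasCount-halfPaths-even : ∀ σ δ → HasCount (IsHalfPath (δ + δ) (σ + δ))
    (∑[ i ≤ suc (σ + σ) / 4 ] multinomial (σ + δ) i (δ + i) (σ ∸ 2 * i))
  HasCount-halfPaths-even σ δ = HasCount-resp-⇔ (λ w → ⇔.trans (mk⇔ (fwd w) (bwd w)) (⇔.sym (IsHalfPath⇔ w)))
    (HasCount-∑ K (λ _ _ p q → trans (sym (proj₁ p)) (proj₁ q))
      (λ i i≤K → HasCount-content i (δ + i) (σ ∸ 2 * i) (total i (2*i≤σ i≤K))))
    where
    K : ℕ
    K = suc (σ + σ) / 4
    regroup : ∀ i δ z → i + (δ + i) + z ≡ (2 * i + z) + δ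
    regroup = solve-∀
    total : ∀ i → 2 * i ≤ σ → i + (δ + i) + (σ ∸ 2 * i) ≡ σ + δ
    total i 2i≤σ = trans (regroup i δ (σ ∸ 2 * i)) (cong (_+ δ) (m+[n∸m]≡n 2i≤σ))
    2*i≤σ : ∀ {i} → i ≤ K → 2 * i ≤ σ
    2*i≤σ {i} i≤K = double-cancel-≤ (≤-trans (≤-reflexive (regroup₄ i))
      (≤-trans (*-monoˡ-≤ 4 i≤K) (≤-trans (m/n*n≤m (suc (σ + σ)) 4) (≤-reflexive (+-comm 1 (σ + σ))))))
      where
      regroup₄ : ∀ i → 2 * i + 2 * i ≡ i * 4
      regroup₄ = solve-∀
    fwd : ∀ w → ∃[ i ] i ≤ K × HasContent i (δ + i) (σ ∸ 2 * i) w → HasHalfPathCounts (δ + δ) (σ + δ) w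
    fwd w (i , i≤K , refl , d≡ , f≡) =
      trans (cong₂ (λ x y → i + x + y) d≡ f≡) (total i (2*i≤σ i≤K)) ,
      subst (λ x → i + i + (δ + δ) ≤ x + x + 1) (sym d≡) (≤-trans (≤-reflexive (regroup₂ i δ)) (m≤m+n _ 1)) ,
      subst (λ x → x + x ≤ i + i + (δ + δ) + 1) (sym d≡) (≤-trans (≤-reflexive (sym (regroup₂ i δ))) (m≤m+n _ 1))
      where
      regroup₂ : ∀ i δ → i + i + (δ + δ) ≡ (δ + i) + (δ + i)
      regroup₂ = solve-∀
    bwd : ∀ w → HasHalfPathCounts (δ + δ) (σ + δ) w →
      ∃[ i ] i ≤ K × HasContent i (δ + i) (σ ∸ 2 * i) w
    bwd w (len , lo , hi) = ups w , i≤K , refl , d≡ , f≡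
      where
      u f : ℕ
      u = ups w
      f = flats w
      regroup₂ : ∀ i δ → i + i + (δ + δ) ≡ (δ + i) + (δ + i)
      regroup₂ = solve-∀
      d≡ : downs w ≡ δ + u
      d≡ = ≤-antisym (double-cancel-≤ (≤-trans hi (≤-reflexive (cong (_+ 1) (regroup₂ u δ)))))
                     (double-cancel-≤ (≤-trans (≤-reflexive (sym (regroup₂ u δ))) lo))
      2u+f≡σ : 2 * u + f ≡ σ
      2u+f≡σ = +-cancelʳ-≡ δ (2 * u + f) σ (trans (sym (regroup u δ f)) (trans (cong (λ x → u + x + f) (sym d≡)) len))
      f≡ : f ≡ σ ∸ 2 * u
      f≡ = sym (trans (cong (_∸ 2 * u) (sym 2u+f≡σ)) (m+n∸m≡n (2 * u) f))
      i≤K : u ≤ K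
      i≤K = subst (_≤ K) (m*n/n≡m u 4) (/-monoˡ-≤ 4 (≤-trans (≤-reflexive (regroup₄ u))
        (≤-trans (+-mono-≤ 2u≤σ 2u≤σ) (n≤1+n (σ + σ)))))
        where
        regroup₄ : ∀ i → i * 4 ≡ 2 * i + 2 * i
        regroup₄ = solve-∀
        2u≤σ : 2 * u ≤ σ
        2u≤σ = ≤-trans (m≤m+n (2 * u) f) (≤-reflexive 2u+f≡σ)

  -- For d = 2δ + 1 the final height is -δ or -δ - 1. Take i = ups + downs - δ: it equals 2 · ups in
  -- the first case and 2 · ups + 1 in the second, so its parity records the case, and flats = σ - i
  -- determines it.
  HasCount-halfPaths-odd : ∀ σ δ → HasCount (IsHalfPath (suc (δ + δ)) (σ + δ))
    (∑[ i ≤ σ ] multinomial (σ + δ) (i / 2) ((suc (δ + δ) + i) / 2) (σ ∸ i))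
  HasCount-halfPaths-odd σ δ = HasCount-resp-⇔ (λ w → ⇔.trans (mk⇔ (fwd w) (bwd w)) (⇔.sym (IsHalfPath⇔ w)))
    (HasCount-∑ σ (λ i≤σ j≤σ p q → ∸-cancelˡ-≡ i≤σ j≤σ (trans (sym (proj₂ (proj₂ p))) (proj₂ (proj₂ q))))
      (λ i i≤σ → HasCount-content (i / 2) ((suc (δ + δ) + i) / 2) (σ ∸ i) (total i i≤σ)))
    where
    Content : ℕ → List Step → Set
    Content i = HasContent (i / 2) ((suc (δ + δ) + i) / 2) (σ ∸ i)
    downs-even : ∀ a → (suc (δ + δ) + (a + a)) / 2 ≡ δ + a
    downs-even a = trans (cong (_/ 2) (regroup δ a)) (half-odd (δ + a))
      where
      regroup : ∀ δ a → suc (δ + δ) + (a + a) ≡ suc ((δ + a) + (δ + a))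
      regroup = solve-∀
    downs-odd : ∀ a → (suc (δ + δ) + suc (a + a)) / 2 ≡ suc (δ + a)
    downs-odd a = trans (cong (_/ 2) (regroup δ a)) (half-even (suc (δ + a)))
      where
      regroup : ∀ δ a → suc (δ + δ) + suc (a + a) ≡ suc (δ + a) + suc (δ + a)
      regroup = solve-∀
    steps≡ : ∀ i → i / 2 + (suc (δ + δ) + i) / 2 ≡ i + δ
    steps≡ i with halve i
    ... | a , inj₁ refl = trans (cong₂ _+_ (half-even a) (downs-even a)) (regroup a δ)
      where
      regroup : ∀ a δ → a + (δ + a) ≡ a + a + δ
      regroup = solve-∀
    ... | a , inj₂ refl = trans (cong₂ _+_ (half-odd a) (downs-odd a)) (regroup a δ)
      where
      regroup : ∀ a δ → a + suc (δ + a) ≡ suc (a + a) + δ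
      regroup = solve-∀
    swap : ∀ i z → i + δ + z ≡ i + z + δ
    swap i z = regroup i δ z
      where
      regroup : ∀ i δ z → i + δ + z ≡ i + z + δ
      regroup = solve-∀
    total : ∀ i → i ≤ σ → i / 2 + (suc (δ + δ) + i) / 2 + (σ ∸ i) ≡ σ + δ
    total i i≤σ = trans (cong (_+ (σ ∸ i)) (steps≡ i)) (trans (swap i (σ ∸ i)) (cong (_+ δ) (m+[n∸m]≡n i≤σ)))
    regroup₁ : ∀ a δ → a + a + suc (δ + δ) ≡ (δ + a) + (δ + a) + 1
    regroup₁ = solve-∀
    regroup₂ : ∀ a δ → a + a + suc (δ + δ) + 1 ≡ suc (δ + a) + suc (δ + a)
    regroup₂ = solve-∀
    near : ∀ i {u v} → u ≡ i / 2 → v ≡ (suc (δ + δ) + i) / 2 →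
      u + u + suc (δ + δ) ≤ v + v + 1 × v + v ≤ u + u + suc (δ + δ) + 1
    near i u≡ v≡ with halve i
    ... | a , inj₁ refl with refl ← trans u≡ (half-even a) | refl ← trans v≡ (downs-even a) =
      ≤-reflexive (regroup₁ a δ) ,
      ≤-trans (m≤m+n _ 1) (≤-trans (≤-reflexive (sym (regroup₁ a δ))) (m≤m+n _ 1))
    ... | a , inj₂ refl with refl ← trans u≡ (half-odd a) | refl ← trans v≡ (downs-odd a) =
      ≤-trans (m≤m+n _ 1) (≤-trans (≤-reflexive (regroup₂ a δ)) (m≤m+n _ 1)) ,
      ≤-reflexive (sym (regroup₂ a δ))
    fwd : ∀ w → ∃[ i ] i ≤ σ × Content i w → HasHalfPathCounts (suc (δ + δ)) (σ + δ) w
    fwd w (i , i≤σ , u≡ , d≡ , f≡) =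
      trans (cong₂ _+_ (cong₂ _+_ u≡ d≡) f≡) (total i i≤σ) , near i u≡ d≡
    bwd : ∀ w → HasHalfPathCounts (suc (δ + δ)) (σ + δ) w →
      ∃[ i ] i ≤ σ × Content i w
    bwd w (len , lo , hi) = cases (m≤n⇒m<n∨m≡n D≤)
      where
      u f : ℕ
      u = ups w
      f = flats w
      ≤D : δ + u ≤ downs w
      ≤D = double-cancel-≤ (≤-trans (m≤m+n _ 1) (≤-trans (≤-reflexive (sym (regroup₁ u δ))) lo))
      D≤ : downs w ≤ suc (δ + u)
      D≤ = double-cancel-≤ (≤-trans hi (≤-trans (≤-reflexive (regroup₂ u δ)) (m≤m+n _ 1)))
      finish : ∀ i → ups w ≡ i / 2 → downs w ≡ (suc (δ + δ) + i) / 2 → ∃[ i ] i ≤ σ × Content i w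
      finish i u≡ d≡ = i , ≤-trans (m≤m+n i f) (≤-reflexive i+f≡σ) , u≡ , d≡ ,
          sym (trans (cong (_∸ i) (sym i+f≡σ)) (m+n∸m≡n i f))
        where
        i+f≡σ : i + f ≡ σ
        i+f≡σ = +-cancelʳ-≡ δ (i + f) σ (trans (sym (swap i f))
          (trans (cong (_+ f) (trans (sym (steps≡ i)) (sym (cong₂ _+_ u≡ d≡)))) len))
      cases : downs w < suc (δ + u) ⊎ downs w ≡ suc (δ + u) → ∃[ i ] i ≤ σ × Content i w
      cases (inj₁ lt) = finish (u + u) (sym (half-even u)) (trans (≤-antisym (s≤s⁻¹ lt) ≤D) (sym (downs-even u)))
      cases (inj₂ eq) = finish (suc (u + u)) (sym (half-odd u)) (trans eq (sym (downs-odd u)))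

-- The three admissible parities of s and d.

open import Data.Nat.Base using (_+_; _*_; _∸_; _<_)
open import Data.Nat.DivMod using (_/_)
open import Data.Nat.Properties using (+-comm)
open import Data.Nat.Tactic.RingSolver using (solve-∀)
open Cores using (module Lattice)
open Heights using (IsHalfPath)
open HalfPaths

coprime-sum : ∀ {s d} → Coprime s d → Coprime (s + d) d
coprime-sum {s} {d} coprime = subst (λ t → Coprime t d) (+-comm d s) (coprime-+ coprime)

2∣double : ∀ k → 2 ∣ k + k
2∣double k = divides k (regroup k)
  where
  regroup : ∀ k → k + k ≡ k * 2
  regroup = solve-∀

2∤1+double : ∀ k → ¬ (2 ∣ suc (k + k))
2∤1+double k 2∣ with () ← ∣1⇒≡1 (∣m+n∣m⇒∣n (subst (2 ∣_) (+-comm 1 (k + k)) 2∣) (2∣double k))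

theorem3p3 : (s d : ℕ) → 0 < s → 0 < d → Coprime s d →
    (2 ∣ d →
    HasCount (IsSelfConjugateCorePartition (s ∷ s + d ∷ s + 2 * d ∷ []))
    (∑[ i ≤ s / 4 ] multinomial ((s + d ∸ 1) / 2) i (d / 2 + i) ((s ∸ 1) / 2 ∸ 2 * i)))
    × (¬ (2 ∣ d) →
    HasCount (IsSelfConjugateCorePartition (s ∷ s + d ∷ s + 2 * d ∷ []))
    (∑[ i ≤ s / 2 ] multinomial ((s + d ∸ 1) / 2) (i / 2) ((d + i) / 2) (s / 2 ∸ i)))
theorem3p3 s d 0<s _ coprime with halve d | halve s
... | δ , inj₁ refl | σ , inj₁ refl with () ← coprime (2∣double σ , 2∣double δ)
... | δ , inj₁ refl | σ , inj₂ refl = (λ _ → even) , (λ 2∤d → ⊥-elim (2∤d (2∣double δ)))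
  where
  s+d≡ : ∀ σ δ → suc (σ + σ) + (δ + δ) ≡ suc (σ + δ + (σ + δ)) + 0
  s+d≡ = solve-∀
  centre≡ : ∀ σ δ → suc (σ + δ + (σ + δ)) ≡ suc (σ + σ) + (δ + δ)
  centre≡ = solve-∀
  cores : ∀ {N} → HasCount (IsHalfPath (δ + δ) (σ + δ)) N →
    HasCount (IsSelfConjugateCorePartition (s ∷ s + d ∷ s + 2 * d ∷ [])) N
  -- Here t = 2(σ + δ) + 1 is odd, so e = 0, and 2c + 1 = t gives c = m.
  cores = Lattice.HasCount-cores s d (s + d) (σ + δ) 0 (σ + δ) 0<s refl (s+d≡ σ δ) z≤n (centre≡ σ δ) (coprime-sum coprime)
  N≡ : (s + d ∸ 1) / 2 ≡ σ + δ
  N≡ = trans (cong (λ n → (n ∸ 1) / 2) (sym (centre≡ σ δ))) (half-even (σ + δ))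
  Sum : ℕ → ℕ → ℕ → ℕ
  Sum N D S = ∑[ i ≤ s / 4 ] multinomial N i (D + i) (S ∸ 2 * i)
  Sum≡ : ∀ {N N′ D D′ S S′} → N ≡ N′ → D ≡ D′ → S ≡ S′ → Sum N D S ≡ Sum N′ D′ S′
  Sum≡ refl refl refl = refl
  even : HasCount (IsSelfConjugateCorePartition (s ∷ s + d ∷ s + 2 * d ∷ [])) (Sum ((s + d ∸ 1) / 2) (d / 2) ((s ∸ 1) / 2))
  even = subst (HasCount _) (sym (Sum≡ N≡ (half-even δ) (half-even σ))) (cores (HasCount-halfPaths-even σ δ))
... | δ , inj₂ refl | halved = (λ 2∣d → ⊥-elim (2∤1+double δ 2∣d)) , (λ _ → odd halved)
  where
  Sum : ℕ → ℕ → ℕ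
  Sum N S = ∑[ i ≤ S ] multinomial N (i / 2) ((d + i) / 2) (S ∸ i)
  s+d≡₀ : ∀ σ δ → σ + σ + suc (δ + δ) ≡ suc (σ + δ + (σ + δ)) + 0
  s+d≡₀ = solve-∀
  centre≡₀ : ∀ σ δ → suc (σ + δ + (σ + δ)) ≡ σ + σ + suc (δ + δ)
  centre≡₀ = solve-∀
  s+d≡₁ : ∀ σ δ → suc (σ + σ) + suc (δ + δ) ≡ suc (σ + δ + (σ + δ)) + 1
  s+d≡₁ = solve-∀
  centre≡₁ : ∀ σ δ → suc (σ + δ + suc δ + (σ + δ + suc δ)) ≡ 1 * suc (δ + δ) + (suc (σ + σ) + suc (δ + δ))
  centre≡₁ = solve-∀
  odd : ∃[ σ ] (s ≡ σ + σ ⊎ s ≡ suc (σ + σ)) →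
    HasCount (IsSelfConjugateCorePartition (s ∷ s + d ∷ s + 2 * d ∷ [])) (Sum ((s + d ∸ 1) / 2) (s / 2))
  odd (σ , inj₁ refl) = subst (HasCount _) (sym (cong₂ Sum N≡ (half-even σ)))
    (Lattice.HasCount-cores s d (s + d) (σ + δ) 0 (σ + δ) 0<s refl (s+d≡₀ σ δ) z≤n (centre≡₀ σ δ) (coprime-sum coprime)
      (HasCount-halfPaths-odd σ δ))
    where
    N≡ : (s + d ∸ 1) / 2 ≡ σ + δ
    N≡ = trans (cong (λ n → (n ∸ 1) / 2) (sym (centre≡₀ σ δ))) (half-even (σ + δ))
  -- Both s and d are odd, so t = 2(σ + δ) + 2 is even: e = 1, and 2c + 1 = d + t gives c = σ + 2δ +
  -- 1.
  odd (σ , inj₂ refl) = subst (HasCount _) (sym (cong₂ Sum N≡ (half-odd σ)))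
    (Lattice.HasCount-cores s d (s + d) (σ + δ) 1 (σ + δ + suc δ) 0<s refl (s+d≡₁ σ δ) (s≤s z≤n) (centre≡₁ σ δ) (coprime-sum coprime)
      (HasCount-halfPaths-odd σ δ))
    where
    N≡ : (s + d ∸ 1) / 2 ≡ σ + δ
    N≡ = trans (cong (_/ 2) (sym (centre≡₀ σ δ))) (half-odd (σ + δ))
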